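{- For $n\ge 0$, $k\ge 0$ let $\bar b_{n,k}$ be the number of connected bipartite graphs of order $n$ and size $k$ on the vertex set $[n]=\{1,\dots,n\}$ (with $\bar b_{0,k}=0$), and let $$\tilde{\mathcal B}(x,y,z)=\sum_{n\ge 1,\,k\ge 0}\bar b_{n,k}\,\frac{1}{n!}\,x^n y^k z_n ,$$ a formal series in $x$, $y$ and infinitely many variables $z_1,z_2,\dots$. Let $\omega=(1,1,1,\dots)$. Then the number of bipartite graphs of given order, size and number of connected components is generated by $\tau_\omega(\exp\tilde{\mathcal B}(x,y,z))$. That is, if $$\tau_\omega(\exp\tilde{\mathcal B})=\sum_{n,k,\nu} b_{n,k,\nu}\,\frac{1}{n!}\,x^n y^k z^\nu,$$ then $b_{n,k,\nu}$ is precisely the number of bipartite graphs on $[n]$ of order $n$ and size $k$ with $\nu$ connected components.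
   Context: All graphs are finite, simple and labeled. The order of a graph is its number of vertices and its size is its number of edges. A graph is bipartite if its vertices can be colored with two colors so that no two adjacent vertices have the same color (a single vertex is a connected bipartite graph). The graph with no vertices is counted once, with $0$ components, corresponding to the constant term $1$. For $\omega=(\omega_1,\omega_2,\dots)\in\mathbb Q^\infty$, $\tau_\omega$ is the ring homomorphism determined by $\prod_i z_i^{\alpha_i}\mapsto z^{\sum_i\omega_i\alpha_i}$; it fixes $x$ and $y$ and is applied coefficientwise to formal power series in $x$. For $\omega=(1,1,1,\dots)$ it sends every $z_i$ to the single variable $z$. -}

module Defs where

open import Data.Bool.Base using (Bool; true; false)
open import Data.Bool.Properties using () renaming (_≟_ to _≟ᵇ_)
open import Data.Fin.Base using (Fin; toℕ; fromℕ<)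
open import Data.Fin.Properties using (any?; all?; toℕ<n; toℕ-injective; toℕ-fromℕ<)
  renaming (_≟_ to _≟ᶠ_; _<?_ to _<ᶠ?_)
open import Data.Fin.Subset using (Subset; _∈_)
open import Data.Fin.Subset.Properties using (_∈?_; anySubset?)
import Data.Integer.Base as ℤ
open import Data.List.Base using
  (List; []; _∷_; [_]; _++_; map; concatMap; filter; length; upTo; allFin; replicate;
   cartesianProduct; cartesianProductWith)
open import Data.Nat.Base using (ℕ; zero; suc; _+_; _∸_; _!; _<_; s≤s⁻¹)
open import Data.Nat.Properties using (m≤n⇒m<n∨m≡n; _!≢0)
  renaming (_≟_ to _≟ⁿ_)
open import Data.Product.Base using (∃; _×_; _,_; map₂)
open import Data.Rational.Base as ℚ using (ℚ; 0ℚ; 1ℚ)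
open import Data.Rational.Properties using () renaming (_≟_ to _≟ℚ_)
open import Data.Sum.Base using (_⊎_; inj₁; inj₂)
open import Data.Vec.Base using (Vec; []; _∷_; lookup)
open import Function.Base using (_∘_)
open import Level using (Level)
open import Relation.Binary.Construct.Closure.ReflexiveTransitive using (Star; ε; _◅_; _◅◅_)
open import Relation.Binary.PropositionalEquality using (_≡_; _≢_; refl; sym; trans; subst)
open import Relation.Nullary.Decidable using (Dec; yes; no; map′; ¬?; _×-dec_; _⊎-dec_; _→-dec_)
open import Relation.Nullary.Negation.Core using (¬_)

private
  variable
    ℓ : Level
    A : Set
    n : ℕ

------------------------------------------------------------------------
-- Labelled graphs

-- Row u of an adjacency matrix is the neighbourhood of u; the vertex i ∈ [n]
-- is the element i - 1 of Fin n.
Matrix : ℕ → Set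
Matrix n = Vec (Subset n) n

Adj : Matrix n → Fin n → Fin n → Set
Adj G u v = v ∈ lookup G u

adj? : (G : Matrix n) → ∀ u v → Dec (Adj G u v)
adj? G u v = v ∈? lookup G u

-- Simple graphs on [n] correspond one-to-one to the matrices satisfying this.
IsSimpleGraph : Matrix n → Set
IsSimpleGraph G = (∀ u v → Adj G u v → Adj G v u) × (∀ u → ¬ Adj G u u)

size : Matrix n → ℕ
size {n} G = length (filter (λ (u , v) → (u <ᶠ? v) ×-dec adj? G u v)
                            (cartesianProduct (allFin n) (allFin n)))

Bipartite : Matrix n → Set
Bipartite {n} G = ∃ λ (c : Vec Bool n) → ∀ u v → Adj G u v → lookup c u ≢ lookup c v

Reachable : Matrix n → Fin n → Fin n → Set
Reachable G = Star (Adj G)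

-- The graph without vertices is not connected (it has 0 components).
Connected : Matrix n → Set
Connected {n} G = Fin n × (∀ u v → Reachable G u v)

-- Components are identified with their vertex sets.
IsComponent : Matrix n → Subset n → Set
IsComponent G C = ∃ λ u → ∀ v → (v ∈ C → Reachable G u v) × (Reachable G u v → v ∈ C)

------------------------------------------------------------------------
-- Decidability

isSimpleGraph? : (G : Matrix n) → Dec (IsSimpleGraph G)
isSimpleGraph? G =
  all? (λ u → all? λ v → adj? G u v →-dec adj? G v u) ×-dec all? (λ u → ¬? (adj? G u u))

bipartite? : (G : Matrix n) → Dec (Bipartite G)
bipartite? G = anySubset? λ c → all? λ u → all? λ v →
  adj? G u v →-dec ¬? (lookup c u ≟ᵇ lookup c v)

-- Reachability is decided by the Floyd–Warshall recursion: Via k u v says that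
-- v can be reached from u through intermediate vertices with index below k.
private
  module FloydWarshall {n : ℕ} (G : Matrix n) where

    Via : ℕ → Fin n → Fin n → Set
    Via zero    u v = u ≡ v ⊎ Adj G u v
    Via (suc k) u v = Via k u v ⊎ ∃ λ w → toℕ w ≡ k × Via k u w × Via k w v

    via? : ∀ k u v → Dec (Via k u v)
    via? zero    u v = (u ≟ᶠ v) ⊎-dec adj? G u v
    via? (suc k) u v =
      via? k u v ⊎-dec any? λ w → (toℕ w ≟ⁿ k) ×-dec (via? k u w ×-dec via? k w v)

    via⇒reachable : ∀ k {u v} → Via k u v → Reachable G u v
    via⇒reachable zero    (inj₁ refl)              = ε
    via⇒reachable zero    (inj₂ e)                 = e ◅ ε
    via⇒reachable (suc k) (inj₁ p)                 = via⇒reachable k p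
    via⇒reachable (suc k) (inj₂ (w , _ , p , q))   = via⇒reachable k p ◅◅ via⇒reachable k q

    to : ∀ k {u w} → toℕ w ≡ k → Via (suc k) u w → Via k u w
    to k w≡k (inj₁ p) = p
    to k {u} w≡k (inj₂ (x , x≡k , p , _)) =
      subst (Via k u) (toℕ-injective (trans x≡k (sym w≡k))) p

    from : ∀ k {w v} → toℕ w ≡ k → Via (suc k) w v → Via k w v
    from k w≡k (inj₁ p) = p
    from k {v = v} w≡k (inj₂ (x , x≡k , _ , q)) =
      subst (λ y → Via k y v) (toℕ-injective (trans x≡k (sym w≡k))) q

    compose : ∀ k {u w v} → toℕ w < k → Via k u w → Via k w v → Via k u v
    compose zero    ()
    compose (suc k) {w = w} w<1+k p q with m≤n⇒m<n∨m≡n (s≤s⁻¹ w<1+k)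
    ... | inj₂ w≡k = inj₂ (w , w≡k , to k w≡k p , from k w≡k q)
    ... | inj₁ w<k with p | q
    ...   | inj₁ p′ | inj₁ q′ = inj₁ (compose k w<k p′ q′)
    ...   | inj₁ p′ | inj₂ (x , x≡k , q₁ , q₂) = inj₂ (x , x≡k , compose k w<k p′ q₁ , q₂)
    ...   | inj₂ (x , x≡k , p₁ , p₂) | inj₁ q′ = inj₂ (x , x≡k , p₁ , compose k w<k p₂ q′)
    ...   | inj₂ (x , x≡k , p₁ , _) | inj₂ (y , y≡k , _ , q₂) =
      inj₂ (x , x≡k , p₁ , subst (λ t → Via k t _) (toℕ-injective (trans y≡k (sym x≡k))) q₂)

    base : ∀ k {u v} → Via 0 u v → Via k u v
    base zero    p = p
    base (suc k) p = inj₁ (base k p)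

    reachable⇒via : ∀ {u v} → Reachable G u v → Via n u v
    reachable⇒via ε = base n (inj₁ refl)
    reachable⇒via (_◅_ {j = w} e r) = compose n (toℕ<n w) (base n (inj₂ e)) (reachable⇒via r)

reachable? : (G : Matrix n) → ∀ u v → Dec (Reachable G u v)
reachable? {n} G u v = map′ (via⇒reachable n) reachable⇒via (via? n u v)
  where open FloydWarshall G

connected? : (G : Matrix n) → Dec (Connected G)
connected? {zero}  G = no λ { (() , _) }
connected? {suc n} G =
  map′ (Fin.zero ,_) (λ (_ , r) → r) (all? λ u → all? λ v → reachable? G u v)

isComponent? : (G : Matrix n) (C : Subset n) → Dec (IsComponent G C)
isComponent? G C = any? λ u → all? λ v →
  (v ∈? C →-dec reachable? G u v) ×-dec (reachable? G u v →-dec v ∈? C)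

------------------------------------------------------------------------
-- Counting

allVecs : List A → ∀ n → List (Vec A n)
allVecs xs zero    = [ [] ]
allVecs xs (suc n) = cartesianProductWith _∷_ xs (allVecs xs n)

allSubsets : ∀ n → List (Subset n)
allSubsets = allVecs (true ∷ false ∷ [])

allMatrices : ∀ n → List (Matrix n)
allMatrices n = allVecs (allSubsets n) n

components : Matrix n → ℕ
components {n} G = length (filter (isComponent? G) (allSubsets n))

countGraphs : ∀ n {P : Matrix n → Set ℓ} → (∀ G → Dec (P G)) → ℕ
countGraphs n P? = length (filter (λ G → isSimpleGraph? G ×-dec P? G) (allMatrices n))

#connectedBipartite : ℕ → ℕ → ℕ
#connectedBipartite n k =
  countGraphs n λ G → connected? G ×-dec (bipartite? G ×-dec (size G ≟ⁿ k))

#bipartite : ℕ → ℕ → ℕ → ℕ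
#bipartite n k ν =
  countGraphs n λ G → bipartite? G ×-dec ((size G ≟ⁿ k) ×-dec (components G ≟ⁿ ν))

------------------------------------------------------------------------
-- Polynomials over ℚ

fromℕ : ℕ → ℚ
fromℕ m = ℤ.+ m ℚ./ 1

1/_! : ℕ → ℚ
1/ n ! = (ℤ.+ 1 ℚ./ (n !)) {{n !≢0}}

-- Finite formal sums of monomials with rational coefficients. The same monomial
-- may occur in several terms; only the total coefficients are meaningful.
FormalSum : Set → Set
FormalSum M = List (ℚ × M)

-- α₁ ∷ … ∷ αᵣ ∷ [] stands for z₁^α₁ ⋯ zᵣ^αᵣ, so trailing zeros are immaterial.
Monomial : Set
Monomial = List ℕ

_∙_ : Monomial → Monomial → Monomial
[]      ∙ β       = β
(a ∷ α) ∙ []      = a ∷ α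
(a ∷ α) ∙ (b ∷ β) = (a + b) ∷ (α ∙ β)

-- z i is the variable with the 1-based index i + 1.
z : ℕ → Monomial
z i = replicate i 0 ++ [ 1 ]

-- The ring ℚ[z₁, z₂, …]
Poly : Set
Poly = FormalSum Monomial

infixl 7 _*ᴾ_ _·ᴾ_

_*ᴾ_ : Poly → Poly → Poly
_*ᴾ_ = cartesianProductWith λ (a , α) (b , β) → (a ℚ.* b , α ∙ β)

_·ᴾ_ : ℚ → Poly → Poly
a ·ᴾ p = map (λ (b , β) → (a ℚ.* b , β)) p

-- ∑ m f = f 0 + ⋯ + f m
∑ : ℕ → (ℕ → Poly) → Poly
∑ m f = concatMap f (upTo (suc m))

-- Rational powers of a single variable: q stands for z^q.
GenPoly : Set
GenPoly = FormalSum ℚ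

-- The coefficient of z^q
coeff : GenPoly → ℚ → ℚ
coeff []             q = 0ℚ
coeff ((a , r) ∷ p) q with r ≟ℚ q
... | yes _ = a ℚ.+ coeff p q
... | no  _ = coeff p q

------------------------------------------------------------------------
-- Formal power series

-- F n k is the coefficient of x^n y^k.
Series : Set → Set
Series C = ℕ → ℕ → C

1ˢ : Series Poly
1ˢ zero zero = [ 1ℚ , [] ]
1ˢ _    _    = []

_*ˢ_ : Series Poly → Series Poly → Series Poly
(F *ˢ G) n k = ∑ n λ i → ∑ k λ j → F i j *ᴾ G (n ∸ i) (k ∸ j)

_^ˢ_ : Series Poly → ℕ → Series Poly
F ^ˢ zero  = 1ˢ
F ^ˢ suc m = F *ˢ (F ^ˢ m)

-- exp F = ∑ₘ Fᵐ / m! for a series F divisible by x: the powers Fᵐ with m > n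
-- do not contribute to x^n, so that the sum may stop at m = n.
exp : Series Poly → Series Poly
exp F n k = ∑ n λ m → 1/ m ! ·ᴾ (F ^ˢ m) n k

-- weight ω α = ∑ᵢ ωᵢ αᵢ, where ω i is the entry with the 1-based index i + 1.
weight : (ℕ → ℚ) → Monomial → ℚ
weight ω []      = 0ℚ
weight ω (a ∷ α) = ω 0 ℚ.* fromℕ a ℚ.+ weight (ω ∘ suc) α

τ : (ℕ → ℚ) → Series Poly → Series GenPoly
τ ω F n k = map (map₂ (weight ω)) (F n k)

𝓑 : Series Poly
𝓑 zero    k = []
𝓑 (suc n) k = [ fromℕ (#connectedBipartite (suc n) k) ℚ.* 1/ (suc n) ! , z n ]

-- F = ∑ b_{n,k,ν} x^n y^k z^ν / n!, with the sum over natural numbers n, k, ν;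
-- in particular all other powers of z have coefficient 0 in F.
record _HasExpansion_ (F : Series GenPoly) (b : ℕ → ℕ → ℕ → ℚ) : Set where
  field
    natural : ∀ n k ν → coeff (F n k) (fromℕ ν) ≡ b n k ν ℚ.* 1/ n !
    other   : ∀ n k q → (∀ ν → q ≢ fromℕ ν) → coeff (F n k) q ≡ 0ℚ

{-# OPTIONS --safe #-}
module Submission where

-- Every term of 𝓑^ν has degree ν in z, so that the coefficient of z^ν in exp 𝓑 is 1/ν! times the
-- total coefficient of 𝓑^ν. This is evaluated by induction on ν: counting in two ways the pairs of
-- a bipartite graph with ν + 1 components and one of its components C, with i = |C|, gives
--   (ν + 1) b(n,k,ν+1) = ∑_{i+r=n} ∑_{j+s=k} n!/(i! r!) b̄(i,j) b(r,s,ν),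
-- because such a graph with component C amounts to a connected graph on C and a graph with ν
-- components on the complement of C.

open import Defs
open import Data.Bool.Base using (Bool; true; false; if_then_else_)
open import Data.Empty using (⊥-elim)
open import Data.Fin.Base as Fin using (Fin)
open import Data.Fin.Properties using () renaming (suc-injective to suc-injectiveᶠ; _<?_ to _<ᶠ?_)
open import Data.Fin.Subset using (Subset; _∈_; _∉_; ∣_∣; ∁)
open import Data.Fin.Subset.Properties using (drop-there)
import Data.Integer.Base as ℤ
import Data.Integer.Properties as ℤ
open import Data.List.Base using
  (List; []; _∷_; _++_; filter; length; map; concatMap; allFin; applyUpTo; upTo;
   cartesianProduct; cartesianProductWith)
open import Data.List.Membership.Propositional using () renaming (_∈_ to _∈ˡ_)
open import Data.List.Membership.Propositional.Properties using
  (∈-map⁺; ∈-map⁻; ∈-++⁺ˡ; ∈-++⁺ʳ; ∈-++⁻; ∈-filter⁺; ∈-filter⁻; ∈-allFin;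
   ∈-cartesianProduct⁺; ∈-cartesianProductWith⁺)
open import Data.List.Membership.Propositional.Properties.WithK using (unique∧set⇒bag)
open import Data.List.Properties using (length-map; length-++)
open import Data.List.Relation.Binary.BagAndSetEquality using (∼bag⇒↭)
open import Data.List.Relation.Binary.Permutation.Propositional.Properties using (↭-length)
open import Data.List.Relation.Unary.All as All using (All; []; _∷_)
import Data.List.Relation.Unary.All.Properties as All
open import Data.List.Relation.Unary.AllPairs using ([]; _∷_)
open import Data.List.Relation.Unary.Any using (here; there)
open import Data.List.Relation.Unary.Unique.Propositional using (Unique)
import Data.List.Relation.Unary.Unique.Propositional.Properties as Unique
open import Data.Nat.Base as ℕ using (ℕ; zero; suc; _∸_; _!; NonZero; s≤s; z≤n; s≤s⁻¹)
open import Data.Nat.Properties as ℕ using (m+n∸m≡n; _!≢0) renaming (_≟_ to _≟ⁿ_)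
open import Data.Product.Base using (∃; _×_; _,_; proj₁; proj₂; map₂)
open import Data.Product.Properties using (,-injectiveˡ; ,-injectiveʳ)
open import Data.Rational.Base using (ℚ; 0ℚ; 1ℚ; _+_; _*_; _/_; fromℚᵘ)
open import Data.Rational.Properties renaming (_≟_ to _≟ℚ_)
open import Data.Rational.Solver using (module +-*-Solver)
import Data.Rational.Unnormalised.Base as ℚᵘ
open import Data.Rational.Unnormalised.Base using (mkℚᵘ; *≡*)
import Data.Rational.Unnormalised.Properties as ℚᵘ
open import Data.Sum.Base using (inj₁; inj₂)
open import Data.Vec.Base using (Vec; []; _∷_; here; there; lookup; tabulate)
open import Data.Vec.Properties using
  ([]=⇒lookup; lookup⇒[]=; lookup∘tabulate; tabulate∘lookup; tabulate-cong; ∷-injective)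
open import Function.Base using (_∘_; id; _$_)
open import Function.Bundles using (_⇔_; mk⇔; Equivalence)
open import Function.Construct.Symmetry using (⇔-sym)
open import Relation.Binary.Construct.Closure.ReflexiveTransitive using
  (ε; _◅_; _◅◅_; gmap; reverse)
open import Relation.Binary.PropositionalEquality using
  (_≡_; _≢_; refl; sym; trans; cong; cong₂; subst; module ≡-Reasoning)
open import Relation.Nullary.Decidable using
  (Dec; yes; no; does; does-⇔; dec-true; dec-false; _×-dec_)
open import Relation.Nullary.Negation using (¬_; contradiction)
open import Relation.Unary using (Decidable)

open Equivalence using (to; from)
open ≡-Reasoning

-- Expanding the power of `𝓑` directly would mean counting partitions of [n] into ν unordered
-- blocks. Marking one component needs only subsets, at the price of the factor ν + 1, which can be
-- cancelled because all counts are carried in ℚ. After division by n! the recurrence is exactly the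
-- rule for the coefficients of a product of series, exponential in x and ordinary in y.
--
-- Two boundary cases remain. For ν = 0 the power is 1, matching the fact that only the graph
-- without vertices has no component. For ν > n the truncated `exp` has no summand left, so b(n,k,ν)
-- must be shown to vanish; the same recurrence yields this.
--
-- With all ω equal to 1 every variable weighs the same, so the exponent of z is the plain degree.
-- Since formal sums are unreduced lists of terms, coefficients are handled through functionals that
-- are additive under concatenation.
--
-- On the graph side, the vertices of a component and of its complement have to be relabelled by
-- initial segments. The relation `IsUnion` records the outcome of this relabelling, and everything
-- else about graphs is derived from it.

private
  variable
    A B : Set
    n : ℕ

-- Enumerations without repetition, and extensionality of subsets and graphs

-- Without repetitions, having the same elements means being permutations of each other. Bijective
-- counts are reduced to this form by mapping one list along an injection.
length-cong : {xs ys : List A} → Unique xs → Unique ys →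
              (∀ {x} → x ∈ˡ xs ⇔ x ∈ˡ ys) → length xs ≡ length ys
length-cong xs! ys! xs≈ys = ↭-length (∼bag⇒↭ (unique∧set⇒bag xs! ys! xs≈ys))

allVecs-unique : {xs : List A} → Unique xs → ∀ n → Unique (allVecs xs n)
allVecs-unique xs! zero    = [] ∷ []
allVecs-unique xs! (suc n) = Unique.cartesianProductWith⁺ _∷_ ∷-injective xs! (allVecs-unique xs! n)

∈-allVecs : {xs : List A} → (∀ x → x ∈ˡ xs) → (v : Vec A n) → v ∈ˡ allVecs xs n
∈-allVecs all []      = here refl
∈-allVecs all (x ∷ v) = ∈-cartesianProductWith⁺ _∷_ (all x) (∈-allVecs all v)

allSubsets-unique : ∀ n → Unique (allSubsets n)
allSubsets-unique = allVecs-unique (((λ ()) ∷ []) ∷ [] ∷ [])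

∈-allSubsets : (C : Subset n) → C ∈ˡ allSubsets n
∈-allSubsets = ∈-allVecs λ { true → here refl ; false → there (here refl) }

allMatrices-unique : ∀ n → Unique (allMatrices n)
allMatrices-unique n = allVecs-unique (allSubsets-unique n) n

∈-allMatrices : (G : Matrix n) → G ∈ˡ allMatrices n
∈-allMatrices = ∈-allVecs ∈-allSubsets

vec-ext : {v w : Vec A n} → (∀ i → lookup v i ≡ lookup w i) → v ≡ w
vec-ext {v = v} {w} eq =
  trans (sym (tabulate∘lookup v)) (trans (tabulate-cong eq) (tabulate∘lookup w))

subset-ext : {C D : Subset n} → (∀ u → u ∈ C ⇔ u ∈ D) → C ≡ D
subset-ext {C = C} {D} C⇔D = vec-ext helper
  where
  helper : ∀ u → lookup C u ≡ lookup D u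
  helper u with lookup C u in Cu | lookup D u in Du
  ... | true  | true  = refl
  ... | false | false = refl
  ... | true  | false = trans (sym ([]=⇒lookup (to (C⇔D u) (lookup⇒[]= u C Cu)))) Du
  ... | false | true  = trans (sym Cu) ([]=⇒lookup (from (C⇔D u) (lookup⇒[]= u D Du)))

matrix-ext : {G H : Matrix n} → (∀ u v → Adj G u v ⇔ Adj H u v) → G ≡ H
matrix-ext G⇔H = vec-ext λ u → subset-ext (G⇔H u)

comprehension : {P : Fin n → Set} → Decidable P → Subset n
comprehension P? = tabulate (does ∘ P?)

∈-comprehension : {P : Fin n → Set} (P? : Decidable P) → ∀ u → u ∈ comprehension P? ⇔ P u
∈-comprehension {P = P} P? u = mk⇔ (λ e → ⇒ (trans (sym (lookup∘tabulate (does ∘ P?) u)) ([]=⇒lookup e)))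
  (λ p → lookup⇒[]= u _ (trans (lookup∘tabulate (does ∘ P?) u) (dec-true (P? u) p)))
  where
  ⇒ : does (P? u) ≡ true → P u
  ⇒ eq with yes p ← P? u = p

matrix : {R : Fin n → Fin n → Set} → (∀ u v → Dec (R u v)) → Matrix n
matrix R? = tabulate λ u → comprehension (R? u)

Adj-matrix : {R : Fin n → Fin n → Set} (R? : ∀ u v → Dec (R u v)) →
             ∀ u v → Adj (matrix R?) u v ⇔ R u v
Adj-matrix R? u v rewrite lookup∘tabulate (λ u → comprehension (R? u)) u = ∈-comprehension (R? u) v

-- Disjoint unions of graphs

-- The increasing enumeration of `C`, by which a graph on `C` is relabelled. Monotonicity matters
-- because `size` counts each edge by its increasing pair of ends.
embed : (C : Subset n) → Fin ∣ C ∣ → Fin n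
embed (true  ∷ C) Fin.zero    = Fin.zero
embed (true  ∷ C) (Fin.suc a) = Fin.suc (embed C a)
embed (false ∷ C) a           = Fin.suc (embed C a)

embed-mono : (C : Subset n) {a b : Fin ∣ C ∣} → a Fin.< b → embed C a Fin.< embed C b
embed-mono (true  ∷ C) {Fin.zero}  {Fin.suc b} _ = s≤s z≤n
embed-mono (true  ∷ C) {Fin.suc a} {Fin.suc b} p = s≤s (embed-mono C (s≤s⁻¹ p))
embed-mono (false ∷ C) p                         = s≤s (embed-mono C p)

embed-cancel : (C : Subset n) {a b : Fin ∣ C ∣} → embed C a Fin.< embed C b → a Fin.< b
embed-cancel (true  ∷ C) {Fin.zero}  {Fin.suc b} _ = s≤s z≤n
embed-cancel (true  ∷ C) {Fin.suc a} {Fin.suc b} p = s≤s (embed-cancel C (s≤s⁻¹ p))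
embed-cancel (false ∷ C) p                         = embed-cancel C (s≤s⁻¹ p)

embed-injective : (C : Subset n) {a b : Fin ∣ C ∣} → embed C a ≡ embed C b → a ≡ b
embed-injective (true  ∷ C) {Fin.zero}  {Fin.zero}  eq = refl
embed-injective (true  ∷ C) {Fin.suc a} {Fin.suc b} eq = cong Fin.suc (embed-injective C (suc-injectiveᶠ eq))
embed-injective (false ∷ C) eq                         = embed-injective C (suc-injectiveᶠ eq)

embed∈ : (C : Subset n) (a : Fin ∣ C ∣) → embed C a ∈ C
embed∈ (true  ∷ C) Fin.zero    = here
embed∈ (true  ∷ C) (Fin.suc a) = there (embed∈ C a)
embed∈ (false ∷ C) a           = there (embed∈ C a)

embed∁∉ : (C : Subset n) (a : Fin ∣ ∁ C ∣) → embed (∁ C) a ∉ C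
embed∁∉ (true  ∷ C) a           p = embed∁∉ C a (drop-there p)
embed∁∉ (false ∷ C) (Fin.suc a) p = embed∁∉ C a (drop-there p)

-- A view of the vertices: matching on `part C u` replaces `u` by an embedded vertex, so that
-- statements about edges split into four cases by the sides of their ends.
data Part (C : Subset n) : Fin n → Set where
  inside  : ∀ a → Part C (embed C a)
  outside : ∀ a → Part C (embed (∁ C) a)

part : (C : Subset n) → ∀ u → Part C u
part (true  ∷ C) Fin.zero = inside Fin.zero
part (false ∷ C) Fin.zero = outside Fin.zero
part (true  ∷ C) (Fin.suc u) with part C u
... | inside  a = inside (Fin.suc a)
... | outside a = outside a
part (false ∷ C) (Fin.suc u) with part C u
... | inside  a = inside a
... | outside a = outside (Fin.suc a)

part-inside : (C : Subset n) → ∀ a → part C (embed C a) ≡ inside a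
part-inside (true  ∷ C) Fin.zero    = refl
part-inside (true  ∷ C) (Fin.suc a) rewrite part-inside C a = refl
part-inside (false ∷ C) a           rewrite part-inside C a = refl

part-outside : (C : Subset n) → ∀ a → part C (embed (∁ C) a) ≡ outside a
part-outside (false ∷ C) Fin.zero    = refl
part-outside (false ∷ C) (Fin.suc a) rewrite part-outside C a = refl
part-outside (true  ∷ C) a           rewrite part-outside C a = refl

glue : (C : Subset n) → (Fin ∣ C ∣ → A) → (Fin ∣ ∁ C ∣ → A) → Fin n → A
glue C f g u with part C u
... | inside  a = f a
... | outside a = g a

glue-inside : (C : Subset n) (f : Fin ∣ C ∣ → A) (g : Fin ∣ ∁ C ∣ → A) →
  ∀ a → glue C f g (embed C a) ≡ f a
glue-inside C f g a rewrite part-inside C a = refl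

glue-outside : (C : Subset n) (f : Fin ∣ C ∣ → A) (g : Fin ∣ ∁ C ∣ → A) →
  ∀ a → glue C f g (embed (∁ C) a) ≡ g a
glue-outside C f g a rewrite part-outside C a = refl

lookup-inside : (C : Subset n) (f : Fin ∣ C ∣ → A) (g : Fin ∣ ∁ C ∣ → A) →
  ∀ b → lookup (tabulate (glue C f g)) (embed C b) ≡ f b
lookup-inside C f g b = trans (lookup∘tabulate _ (embed C b)) (glue-inside C f g b)

lookup-outside : (C : Subset n) (f : Fin ∣ C ∣ → A) (g : Fin ∣ ∁ C ∣ → A) →
  ∀ b → lookup (tabulate (glue C f g)) (embed (∁ C) b) ≡ g b
lookup-outside C f g b = trans (lookup∘tabulate _ (embed (∁ C) b)) (glue-outside C f g b)

-- A relation rather than an equation with `union`, so that the same lemmas serve a graph built from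
-- two parts and a given graph cut along one of its components.
record IsUnion (C : Subset n) (G : Matrix n) (H : Matrix ∣ C ∣) (K : Matrix ∣ ∁ C ∣) : Set where
  field
    inner : ∀ a b → Adj G (embed C a) (embed C b) ⇔ Adj H a b
    outer : ∀ a b → Adj G (embed (∁ C) a) (embed (∁ C) b) ⇔ Adj K a b
    no→   : ∀ a b → ¬ Adj G (embed C a) (embed (∁ C) b)
    no←   : ∀ a b → ¬ Adj G (embed (∁ C) a) (embed C b)

open IsUnion

union : (C : Subset n) → Matrix ∣ C ∣ × Matrix ∣ ∁ C ∣ → Matrix n
union C (H , K) = tabulate $ glue C
  (λ a → tabulate (glue C (lookup (lookup H a)) (λ _ → false)))
  (λ a → tabulate (glue C (λ _ → false) (lookup (lookup K a))))

module _ {C : Subset n} {H : Matrix ∣ C ∣} {K : Matrix ∣ ∁ C ∣} where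
  private
    rowᵢ : Fin ∣ C ∣ → Subset n
    rowᵢ a = tabulate (glue C (lookup (lookup H a)) (λ _ → false))

    rowₒ : Fin ∣ ∁ C ∣ → Subset n
    rowₒ a = tabulate (glue C (λ _ → false) (lookup (lookup K a)))

    row-inside : ∀ a → lookup (union C (H , K)) (embed C a) ≡ rowᵢ a
    row-inside a = lookup-inside C rowᵢ rowₒ a

    row-outside : ∀ a → lookup (union C (H , K)) (embed (∁ C) a) ≡ rowₒ a
    row-outside a = lookup-outside C rowᵢ rowₒ a

    Adj⇔ : ∀ {u r m v} {D : Subset m} {w} → lookup (union C (H , K)) u ≡ r →
           lookup r v ≡ lookup D w → Adj (union C (H , K)) u v ⇔ w ∈ D
    Adj⇔ {v = v} {D} {w} refl eq = mk⇔
      (λ e → lookup⇒[]= w D (trans (sym eq) ([]=⇒lookup e)))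
      (λ e → lookup⇒[]= v _ (trans eq ([]=⇒lookup e)))

    -- The constant `false` in a glued row is read as the entry of a one-element vector, so that
    -- `Adj⇔` also yields the absence of edges between the two sides.
    ∉[false] : ¬ (Fin.zero ∈ (false ∷ []))
    ∉[false] ()

  union-isUnion : IsUnion C (union C (H , K)) H K
  union-isUnion = record
    { inner = λ a b → Adj⇔ (row-inside a) (lookup-inside C _ _ b)
    ; outer = λ a b → Adj⇔ (row-outside a) (lookup-outside C _ _ b)
    ; no→ = λ a b → ∉[false] ∘ to (Adj⇔ (row-inside a) (lookup-outside C _ _ b))
    ; no← = λ a b → ∉[false] ∘ to (Adj⇔ (row-outside a) (lookup-inside C _ _ b))
    }

-- This gives surjectivity of the decomposition: a simple graph with component `C` equals the
-- `union` of its two restrictions. Injectivity comes from `parts-unique`.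
union-unique : {C : Subset n} {G G′ : Matrix n} {H : Matrix ∣ C ∣} {K : Matrix ∣ ∁ C ∣} →
               IsUnion C G H K → IsUnion C G′ H K → G ≡ G′
union-unique {C = C} {G} {G′} U U′ = matrix-ext eq
  where
  eq : ∀ u v → Adj G u v ⇔ Adj G′ u v
  eq u v with part C u | part C v
  ... | inside  a | inside  b =
    mk⇔ (from (inner U′ a b) ∘ to (inner U a b)) (from (inner U a b) ∘ to (inner U′ a b))
  ... | outside a | outside b =
    mk⇔ (from (outer U′ a b) ∘ to (outer U a b)) (from (outer U a b) ∘ to (outer U′ a b))
  ... | inside  a | outside b = mk⇔ (⊥-elim ∘ no→ U a b) (⊥-elim ∘ no→ U′ a b)
  ... | outside a | inside  b = mk⇔ (⊥-elim ∘ no← U a b) (⊥-elim ∘ no← U′ a b)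

parts-unique : {C : Subset n} {G : Matrix n} {H H′ : Matrix ∣ C ∣} {K K′ : Matrix ∣ ∁ C ∣} →
               IsUnion C G H K → IsUnion C G H′ K′ → (H , K) ≡ (H′ , K′)
parts-unique U U′ = cong₂ _,_
  (matrix-ext λ a b → mk⇔ (to (inner U′ a b) ∘ from (inner U a b)) (to (inner U a b) ∘ from (inner U′ a b)))
  (matrix-ext λ a b → mk⇔ (to (outer U′ a b) ∘ from (outer U a b)) (to (outer U a b) ∘ from (outer U′ a b)))

union-injective : (C : Subset n) {x y : Matrix ∣ C ∣ × Matrix ∣ ∁ C ∣} → union C x ≡ union C y → x ≡ y
union-injective C {x} {y} eq =
  parts-unique union-isUnion (subst (λ G → IsUnion C G (proj₁ y) (proj₂ y)) (sym eq) union-isUnion)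

restrict : (C : Subset n) → Matrix n → Matrix ∣ C ∣
restrict C G = matrix λ a b → adj? G (embed C a) (embed C b)

-- The set of vertices reachable from `u` is closed under adjacency, so no edge leaves `C`; by
-- symmetry none enters it.
component⇒isUnion : {C : Subset n} {G : Matrix n} → IsSimpleGraph G → IsComponent G C →
                    IsUnion C G (restrict C G) (restrict (∁ C) G)
component⇒isUnion {C = C} {G} (symG , _) (u , C⇔) = record
  { inner = λ a b → ⇔-sym (Adj-matrix (λ a b → adj? G (embed C a) (embed C b)) a b)
  ; outer = λ a b → ⇔-sym (Adj-matrix (λ a b → adj? G (embed (∁ C) a) (embed (∁ C) b)) a b)
  ; no→ = no-leave
  ; no← = λ a b e → no-leave b a (symG _ _ e)
  }
  where
  no-leave : ∀ a b → ¬ Adj G (embed C a) (embed (∁ C) b)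
  no-leave a b e = embed∁∉ C b (proj₂ (C⇔ _) (proj₁ (C⇔ _) (embed∈ C a) ◅◅ (e ◅ ε)))

-- Properties and invariants of a disjoint union in terms of its parts

module _ {C : Subset n} {G : Matrix n} {H : Matrix ∣ C ∣} {K : Matrix ∣ ∁ C ∣} (U : IsUnion C G H K) where

  simple⇔ : IsSimpleGraph G ⇔ (IsSimpleGraph H × IsSimpleGraph K)
  simple⇔ = mk⇔ ⇒ ⇐
    where
    ⇒ : IsSimpleGraph G → IsSimpleGraph H × IsSimpleGraph K
    ⇒ (symG , irr) =
      ( (λ a b → to (inner U b a) ∘ symG _ _ ∘ from (inner U a b))
      , (λ a → irr _ ∘ from (inner U a a)) ) ,
      ( (λ a b → to (outer U b a) ∘ symG _ _ ∘ from (outer U a b))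
      , (λ a → irr _ ∘ from (outer U a a)) )

    ⇐ : IsSimpleGraph H × IsSimpleGraph K → IsSimpleGraph G
    ⇐ ((symH , irrH) , (symK , irrK)) = symG , irrG
      where
      symG : ∀ u v → Adj G u v → Adj G v u
      symG u v with part C u | part C v
      ... | inside  a | inside  b = from (inner U b a) ∘ symH a b ∘ to (inner U a b)
      ... | outside a | outside b = from (outer U b a) ∘ symK a b ∘ to (outer U a b)
      ... | inside  a | outside b = ⊥-elim ∘ no→ U a b
      ... | outside a | inside  b = ⊥-elim ∘ no← U a b

      irrG : ∀ u → ¬ Adj G u u
      irrG u with part C u
      ... | inside  a = irrH a ∘ to (inner U a a)
      ... | outside a = irrK a ∘ to (outer U a a)

  -- Any two proper colourings of the parts can be glued, since no edge compares a colour on one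
  -- side with a colour on the other.
  bipartite⇔ : Bipartite G ⇔ (Bipartite H × Bipartite K)
  bipartite⇔ = mk⇔ ⇒ ⇐
    where
    ⇒ : Bipartite G → Bipartite H × Bipartite K
    ⇒ (c , proper) =
      ( tabulate (lookup c ∘ embed C) , λ a b e eq →
          proper _ _ (from (inner U a b) e) (untabulate (embed C) a b eq) ) ,
      ( tabulate (lookup c ∘ embed (∁ C)) , λ a b e eq →
          proper _ _ (from (outer U a b) e) (untabulate (embed (∁ C)) a b eq) )
      where
      untabulate : ∀ {m} (f : Fin m → Fin n) a b →
                   lookup (tabulate (lookup c ∘ f)) a ≡ lookup (tabulate (lookup c ∘ f)) b →
                   lookup c (f a) ≡ lookup c (f b)
      untabulate f a b eq = trans (sym (lookup∘tabulate _ a)) (trans eq (lookup∘tabulate _ b))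

    ⇐ : Bipartite H × Bipartite K → Bipartite G
    ⇐ ((c , properH) , (d , properK)) = tabulate col , λ u v e eq →
      proper u v e (trans (sym (lookup∘tabulate col u)) (trans eq (lookup∘tabulate col v)))
      where
      col : Fin n → Bool
      col = glue C (lookup c) (lookup d)

      proper : ∀ u v → Adj G u v → col u ≢ col v
      proper u v with part C u | part C v
      ... | inside  a | inside  b = properH a b ∘ to (inner U a b)
      ... | outside a | outside b = properK a b ∘ to (outer U a b)
      ... | inside  a | outside b = ⊥-elim ∘ no→ U a b
      ... | outside a | inside  b = ⊥-elim ∘ no← U a b

  size-union : size G ≡ size H ℕ.+ size K
  size-union = begin
    length (edges G)
      ≡⟨ length-cong (edges! G) parts! (mk⇔ ⇒ ⇐) ⟩
    length (map embed² (edges H) ++ map embed∁² (edges K))  ≡⟨ length-++ (map embed² (edges H)) ⟩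
    length (map embed² (edges H)) ℕ.+ length (map embed∁² (edges K))
      ≡⟨ cong₂ ℕ._+_ (length-map embed² (edges H)) (length-map embed∁² (edges K)) ⟩
    size H ℕ.+ size K ∎
    where
    edge? : ∀ {m} (L : Matrix m) → Decidable (λ (u , v) → (u Fin.< v) × Adj L u v)
    edge? L (u , v) = (u <ᶠ? v) ×-dec adj? L u v

    pairs : ∀ m → List (Fin m × Fin m)
    pairs m = cartesianProduct (allFin m) (allFin m)

    edges : ∀ {m} → Matrix m → List (Fin m × Fin m)
    edges {m} L = filter (edge? L) (pairs m)

    edges! : ∀ {m} (L : Matrix m) → Unique (edges L)
    edges! {m} L = Unique.filter⁺ (edge? L) (Unique.cartesianProduct⁺ (Unique.allFin⁺ m) (Unique.allFin⁺ m))

    ∈-edges : ∀ {m} (L : Matrix m) {u v} → (u , v) ∈ˡ edges L ⇔ (u Fin.< v × Adj L u v)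
    ∈-edges L {u} {v} = mk⇔ (proj₂ ∘ ∈-filter⁻ (edge? L) {xs = pairs _})
      (∈-filter⁺ (edge? L) (∈-cartesianProduct⁺ (∈-allFin u) (∈-allFin v)))

    embed² : Fin ∣ C ∣ × Fin ∣ C ∣ → Fin n × Fin n
    embed² (a , b) = embed C a , embed C b

    embed∁² : Fin ∣ ∁ C ∣ × Fin ∣ ∁ C ∣ → Fin n × Fin n
    embed∁² (a , b) = embed (∁ C) a , embed (∁ C) b

    parts! : Unique (map embed² (edges H) ++ map embed∁² (edges K))
    parts! = Unique.++⁺
      (Unique.map⁺ (pair-injective (embed-injective C)) (edges! H))
      (Unique.map⁺ (pair-injective (embed-injective (∁ C))) (edges! K))
      disjoint
      where
      pair-injective : ∀ {m} {f : Fin m → Fin n} → (∀ {a b} → f a ≡ f b → a ≡ b) →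
                       ∀ {x y : Fin m × Fin m} →
                       (f (proj₁ x) , f (proj₂ x)) ≡ (f (proj₁ y) , f (proj₂ y)) → x ≡ y
      pair-injective inj eq = cong₂ _,_ (inj (,-injectiveˡ eq)) (inj (,-injectiveʳ eq))

      disjoint : ∀ {e} → ¬ (e ∈ˡ map embed² (edges H) × e ∈ˡ map embed∁² (edges K))
      disjoint (p , q) with ∈-map⁻ embed² p | ∈-map⁻ embed∁² q
      ... | (a , _) , _ , refl | (b , _) , _ , eq =
        embed∁∉ C b (subst (_∈ C) (,-injectiveˡ eq) (embed∈ C a))

    ⇒ : ∀ {e} → e ∈ˡ edges G → e ∈ˡ map embed² (edges H) ++ map embed∁² (edges K)
    ⇒ {u , v} e with to (∈-edges G) e | part C u | part C v
    ... | u<v , uv | inside  a | inside  b =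
      ∈-++⁺ˡ (∈-map⁺ embed² (from (∈-edges H) (embed-cancel C u<v , to (inner U a b) uv)))
    ... | u<v , uv | outside a | outside b =
      ∈-++⁺ʳ _ (∈-map⁺ embed∁² (from (∈-edges K) (embed-cancel (∁ C) u<v , to (outer U a b) uv)))
    ... | _   , uv | inside  a | outside b = ⊥-elim (no→ U a b uv)
    ... | _   , uv | outside a | inside  b = ⊥-elim (no← U a b uv)

    ⇐ : ∀ {e} → e ∈ˡ map embed² (edges H) ++ map embed∁² (edges K) → e ∈ˡ edges G
    ⇐ e with ∈-++⁻ (map embed² (edges H)) e
    ... | inj₁ p with (a , b) , ab , refl ← ∈-map⁻ embed² p =
      let a<b , e = to (∈-edges H) ab in from (∈-edges G) (embed-mono C a<b , from (inner U a b) e)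
    ... | inj₂ p with (a , b) , ab , refl ← ∈-map⁻ embed∁² p =
      let a<b , e = to (∈-edges K) ab in from (∈-edges G) (embed-mono (∁ C) a<b , from (outer U a b) e)

  reachable-inside⁺ : ∀ {a b} → Reachable H a b → Reachable G (embed C a) (embed C b)
  reachable-inside⁺ = gmap (embed C) (from (inner U _ _))

  reachable-outside⁺ : ∀ {a b} → Reachable K a b → Reachable G (embed (∁ C) a) (embed (∁ C) b)
  reachable-outside⁺ = gmap (embed (∁ C)) (from (outer U _ _))

  -- A walk that starts in `C` never leaves it, so it can be pulled back to `H` edge by edge.
  reachable-inside⁻ : ∀ {u v} → Reachable G u v → ∀ a → u ≡ embed C a →
                      ∃ λ b → v ≡ embed C b × Reachable H a b
  reachable-inside⁻ ε a eq = a , eq , ε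
  reachable-inside⁻ (_◅_ {j = w} e r) a refl with part C w
  ... | outside b = ⊥-elim (no→ U a b e)
  ... | inside  b = let c , eq , r′ = reachable-inside⁻ r b refl in c , eq , to (inner U a b) e ◅ r′

  reachable-outside⁻ : ∀ {u v} → Reachable G u v → ∀ a → u ≡ embed (∁ C) a →
                       ∃ λ b → v ≡ embed (∁ C) b × Reachable K a b
  reachable-outside⁻ ε a eq = a , eq , ε
  reachable-outside⁻ (_◅_ {j = w} e r) a refl with part C w
  ... | inside  b = ⊥-elim (no← U a b e)
  ... | outside b = let c , eq , r′ = reachable-outside⁻ r b refl in c , eq , to (outer U a b) e ◅ r′

  inside⇒reachable : Connected H → ∀ a {v} → v ∈ C → Reachable G (embed C a) v
  inside⇒reachable (_ , conn) a {v} v∈C with part C v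
  ... | inside  b = reachable-inside⁺ (conn a b)
  ... | outside b = contradiction v∈C (embed∁∉ C b)

  reachable⇒inside : ∀ a {v} → Reachable G (embed C a) v → v ∈ C
  reachable⇒inside a r with b , refl , _ ← reachable-inside⁻ r a refl = embed∈ C b

  connected⇔ : IsSimpleGraph G → IsComponent G C ⇔ Connected H
  connected⇔ (symG , _) = mk⇔ ⇒ λ conn → embed C (proj₁ conn) , λ v →
    inside⇒reachable conn (proj₁ conn) , reachable⇒inside (proj₁ conn)
    where
    ⇒ : IsComponent G C → Connected H
    ⇒ (u , C⇔) with part C u
    ... | outside a = contradiction (proj₂ (C⇔ _) ε) (embed∁∉ C a)
    ... | inside  a = a , conn
      where
      conn : ∀ b c → Reachable H b c
      -- The walk goes from `b` back to the base vertex of the component, reversed by the symmetry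
      -- of `G`, and from there on to `c`.
      conn b c with reachable-inside⁻
        (reverse (symG _ _) (proj₁ (C⇔ _) (embed∈ C b)) ◅◅ proj₁ (C⇔ _) (embed∈ C c))
        b refl
      ... | c′ , eq , r rewrite embed-injective C eq = r

  -- Every component is the reachable set of some vertex. If this vertex lies in `C`, the component
  -- is `C` itself; otherwise it is a component of `K`, carried over by `extend`.
  components-union : Connected H → components G ≡ suc (components K)
  components-union conn@(a₀ , _) = begin
    components G
      ≡⟨ length-cong (comps! G) parts! (mk⇔ ⇒ ⇐) ⟩
    suc (length (map extend (comps K)))
      ≡⟨ cong suc (length-map extend (comps K)) ⟩
    suc (components K) ∎
    where
    comps : ∀ {m} → Matrix m → List (Subset m)
    comps L = filter (isComponent? L) (allSubsets _)

    comps! : ∀ {m} (L : Matrix m) → Unique (comps L)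
    comps! L = Unique.filter⁺ (isComponent? L) (allSubsets-unique _)

    ∈-comps : ∀ {m} (L : Matrix m) {D} → D ∈ˡ comps L ⇔ IsComponent L D
    ∈-comps L {D} = mk⇔ (proj₂ ∘ ∈-filter⁻ (isComponent? L) {xs = allSubsets _})
      (∈-filter⁺ (isComponent? L) (∈-allSubsets D))

    extend : Subset ∣ ∁ C ∣ → Subset n
    extend D = tabulate (glue C (λ _ → false) (lookup D))

    extend-inside : ∀ D a → embed C a ∉ extend D
    extend-inside D a p with () ← trans (sym ([]=⇒lookup p))
      (lookup-inside C (λ _ → false) (lookup D) a)

    extend-outside : ∀ D a → embed (∁ C) a ∈ extend D ⇔ a ∈ D
    extend-outside D a = mk⇔ (λ p → lookup⇒[]= a D (trans (sym eq) ([]=⇒lookup p)))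
      (λ p → lookup⇒[]= _ _ (trans eq ([]=⇒lookup p)))
      where
      eq : lookup (extend D) (embed (∁ C) a) ≡ lookup D a
      eq = lookup-outside C (λ _ → false) (lookup D) a

    extend-injective : ∀ {D D′} → extend D ≡ extend D′ → D ≡ D′
    extend-injective {D} {D′} eq = subset-ext λ a → mk⇔
      (λ p → to (extend-outside D′ a) (subst (_ ∈_) eq (from (extend-outside D a) p)))
      (λ p → to (extend-outside D a) (subst (_ ∈_) (sym eq) (from (extend-outside D′ a) p)))

    extend-component : ∀ {D} → IsComponent K D → IsComponent G (extend D)
    extend-component {D} (a , D⇔) = embed (∁ C) a , λ v → forth v , back v
      where
      forth : ∀ v → v ∈ extend D → Reachable G (embed (∁ C) a) v
      forth v p with part C v
      ... | inside  b = contradiction p (extend-inside D b)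
      ... | outside b = reachable-outside⁺ (proj₁ (D⇔ b) (to (extend-outside D b) p))

      back : ∀ v → Reachable G (embed (∁ C) a) v → v ∈ extend D
      back v r with b , refl , r′ ← reachable-outside⁻ r a refl =
        from (extend-outside D b) (proj₂ (D⇔ b) r′)

    parts! : Unique (C ∷ map extend (comps K))
    parts! = All.tabulate C≢ ∷ Unique.map⁺ extend-injective (comps! K)
      where
      -- The vertex `a₀`, supplied by the connectedness of `H`, lies in `C` but in no extended set.
      C≢ : ∀ {D} → D ∈ˡ map extend (comps K) → C ≢ D
      C≢ p refl with D , _ , eq ← ∈-map⁻ extend p =
        extend-inside D a₀ (subst (embed C a₀ ∈_) eq (embed∈ C a₀))

    ⇐ : ∀ {D} → D ∈ˡ C ∷ map extend (comps K) → D ∈ˡ comps G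
    ⇐ (here refl) = from (∈-comps G) (embed C a₀ , λ v → inside⇒reachable conn a₀ , reachable⇒inside a₀)
    ⇐ (there p) with D , q , refl ← ∈-map⁻ extend p =
      from (∈-comps G) (extend-component (to (∈-comps K) q))

    ⇒ : ∀ {D} → D ∈ˡ comps G → D ∈ˡ C ∷ map extend (comps K)
    ⇒ {D} p with u , D⇔ ← to (∈-comps G) p with part C u
    ... | inside  a = here (subset-ext λ v → mk⇔
      (reachable⇒inside a ∘ proj₁ (D⇔ v)) (proj₂ (D⇔ v) ∘ inside⇒reachable conn a))
    ... | outside a = there (subst (_∈ˡ map extend (comps K)) (sym D≡)
      (∈-map⁺ extend (from (∈-comps K) D′-component)))
      where
      D′ : Subset ∣ ∁ C ∣
      D′ = comprehension (reachable? K a)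

      D′-component : IsComponent K D′
      D′-component = a , λ b → to (∈-comprehension (reachable? K a) b) , from (∈-comprehension (reachable? K a) b)

      -- Both are the set of vertices reachable from the same vertex `embed (∁ C) a`.
      D≡ : D ≡ extend D′
      D≡ = subset-ext λ v → mk⇔ (proj₂ (proj₂ (extend-component D′-component) v) ∘ proj₁ (D⇔ v))
                                (proj₂ (D⇔ v) ∘ proj₁ (proj₂ (extend-component D′-component) v))

-- Rational numbers and sums

-- Fractions written with `_/_` are values of `fromℚᵘ` by computation, so with these two
-- homomorphism laws identities between them become equalities of integer cross products.
fromℚᵘ-homo-+ : ∀ p q → fromℚᵘ (p ℚᵘ.+ q) ≡ fromℚᵘ p + fromℚᵘ q
fromℚᵘ-homo-+ p q = toℚᵘ-injective (ℚᵘ.≃-trans (toℚᵘ-fromℚᵘ (p ℚᵘ.+ q)) (ℚᵘ.≃-sym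
  (ℚᵘ.≃-trans (toℚᵘ-homo-+ (fromℚᵘ p) (fromℚᵘ q)) (ℚᵘ.+-cong (toℚᵘ-fromℚᵘ p) (toℚᵘ-fromℚᵘ q)))))

fromℚᵘ-homo-* : ∀ p q → fromℚᵘ (p ℚᵘ.* q) ≡ fromℚᵘ p * fromℚᵘ q
fromℚᵘ-homo-* p q = toℚᵘ-injective (ℚᵘ.≃-trans (toℚᵘ-fromℚᵘ (p ℚᵘ.* q)) (ℚᵘ.≃-sym
  (ℚᵘ.≃-trans (toℚᵘ-homo-* (fromℚᵘ p) (fromℚᵘ q)) (ℚᵘ.*-cong (toℚᵘ-fromℚᵘ p) (toℚᵘ-fromℚᵘ q)))))

fromℕ-+ : ∀ m n → fromℕ (m ℕ.+ n) ≡ fromℕ m + fromℕ n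
fromℕ-+ m n = trans (fromℚᵘ-cong {mkℚᵘ (ℤ.+ (m ℕ.+ n)) 0} {mkℚᵘ (ℤ.+ m) 0 ℚᵘ.+ mkℚᵘ (ℤ.+ n) 0} (*≡* eq))
  (fromℚᵘ-homo-+ (mkℚᵘ (ℤ.+ m) 0) (mkℚᵘ (ℤ.+ n) 0))
  where
  eq : ℤ.+ (m ℕ.+ n) ℤ.* ℤ.+ 1 ≡ (ℤ.+ m ℤ.* ℤ.+ 1 ℤ.+ ℤ.+ n ℤ.* ℤ.+ 1) ℤ.* ℤ.+ 1
  eq = cong (ℤ._* ℤ.+ 1) (sym (cong₂ ℤ._+_ (ℤ.*-identityʳ (ℤ.+ m)) (ℤ.*-identityʳ (ℤ.+ n))))

fromℕ-suc : ∀ n → fromℕ (suc n) ≡ 1ℚ + fromℕ n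
fromℕ-suc = fromℕ-+ 1

fromℕ-injective : ∀ {m n} → fromℕ m ≡ fromℕ n → m ≡ n
fromℕ-injective {m} {n} eq with *≡* eq′ ← fromℚᵘ-injective {mkℚᵘ (ℤ.+ m) 0} {mkℚᵘ (ℤ.+ n) 0} eq =
  ℤ.+-injective (trans (sym (ℤ.*-identityʳ (ℤ.+ m))) (trans eq′ (ℤ.*-identityʳ (ℤ.+ n))))

fromℕ*1/ : ∀ m d .{{_ : NonZero m}} .{{_ : NonZero d}} .{{_ : NonZero (m ℕ.* d)}} →
           fromℕ m * (ℤ.+ 1 / (m ℕ.* d)) ≡ ℤ.+ 1 / d
fromℕ*1/ (suc m) (suc d) = trans (sym (fromℚᵘ-homo-* (mkℚᵘ (ℤ.+ suc m) 0) (mkℚᵘ (ℤ.+ 1) (d ℕ.+ m ℕ.* suc d))))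
  (fromℚᵘ-cong {mkℚᵘ (ℤ.+ suc m) 0 ℚᵘ.* mkℚᵘ (ℤ.+ 1) (d ℕ.+ m ℕ.* suc d)} {mkℚᵘ (ℤ.+ 1) d} (*≡* eq))
  where
  eq : ℤ.+ suc m ℤ.* ℤ.+ 1 ℤ.* ℤ.+ suc d ≡ ℤ.+ 1 ℤ.* (ℤ.+ 1 ℤ.* ℤ.+ (suc m ℕ.* suc d))
  eq = trans (cong (ℤ._* ℤ.+ suc d) (ℤ.*-identityʳ (ℤ.+ suc m)))
    (trans (sym (ℤ.pos-* (suc m) (suc d))) (sym (trans (ℤ.*-identityˡ _) (ℤ.*-identityˡ _))))

suc*1/! : ∀ n → fromℕ (suc n) * 1/ suc n ! ≡ 1/ n !
suc*1/! n = fromℕ*1/ (suc n) (n !) {{_}} {{n !≢0}} {{suc n !≢0}}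

*-cancelˡ-suc : ∀ n {p q} → fromℕ (suc n) * p ≡ fromℕ (suc n) * q → p ≡ q
*-cancelˡ-suc n {p} {q} eq = trans (sym (lem p)) (trans (cong (r *_) eq) (lem q))
  where
  r = ℤ.+ 1 / suc n
  r*suc : r * fromℕ (suc n) ≡ 1ℚ
  r*suc = trans (*-comm r _) (trans (cong (λ d → fromℕ (suc n) * (ℤ.+ 1 / suc d)) (sym (ℕ.*-identityʳ n)))
    (fromℕ*1/ (suc n) 1))
  lem : ∀ p → r * (fromℕ (suc n) * p) ≡ p
  lem p = trans (sym (*-assoc r _ p)) (trans (cong (_* p) r*suc) (*-identityˡ p))

-- Multiplication by n + 1 lowers 1/(n+1)! to 1/n!, so induction ends at 1/0! = 1.
*-cancelʳ-1/! : ∀ n {p q} → p * 1/ n ! ≡ q * 1/ n ! → p ≡ q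
*-cancelʳ-1/! zero {p} {q} eq = trans (sym (*-identityʳ p)) (trans eq (*-identityʳ q))
*-cancelʳ-1/! (suc n) {p} {q} eq = *-cancelʳ-1/! n (trans (lem p) (trans (cong (fromℕ (suc n) *_) eq) (sym (lem q))))
  where
  open +-*-Solver
  lem : ∀ p → p * 1/ n ! ≡ fromℕ (suc n) * (p * 1/ suc n !)
  lem p = trans (cong (p *_) (sym (suc*1/! n)))
    (solve 3 (λ p a b → p :* (a :* b) := a :* (p :* b)) refl p (fromℕ (suc n)) (1/ suc n !))

interchange : ∀ a b c d → (a + b) + (c + d) ≡ (a + c) + (b + d)
interchange = solve 4 (λ a b c d → (a :+ b) :+ (c :+ d) := (a :+ c) :+ (b :+ d)) refl
  where open +-*-Solver

-- Finite sums, indicators and convolutions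

Σ : List A → (A → ℚ) → ℚ
Σ []       f = 0ℚ
Σ (x ∷ xs) f = f x + Σ xs f

Σ-cong : ∀ (xs : List A) {f g : A → ℚ} → (∀ x → f x ≡ g x) → Σ xs f ≡ Σ xs g
Σ-cong []       eq = refl
Σ-cong (x ∷ xs) eq = cong₂ _+_ (eq x) (Σ-cong xs eq)

Σ-zero : ∀ (xs : List A) → Σ xs (λ _ → 0ℚ) ≡ 0ℚ
Σ-zero []       = refl
Σ-zero (x ∷ xs) = trans (+-identityˡ _) (Σ-zero xs)

Σ-++ : ∀ (xs ys : List A) f → Σ (xs ++ ys) f ≡ Σ xs f + Σ ys f
Σ-++ []       ys f = sym (+-identityˡ _)
Σ-++ (x ∷ xs) ys f = trans (cong (f x +_) (Σ-++ xs ys f)) (sym (+-assoc (f x) _ _))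

Σ-map : ∀ (g : A → B) xs f → Σ (map g xs) f ≡ Σ xs (f ∘ g)
Σ-map g []       f = refl
Σ-map g (x ∷ xs) f = cong (f (g x) +_) (Σ-map g xs f)

Σ-+ : ∀ (xs : List A) f g → Σ xs (λ x → f x + g x) ≡ Σ xs f + Σ xs g
Σ-+ []       f g = refl
Σ-+ (x ∷ xs) f g = trans (cong ((f x + g x) +_) (Σ-+ xs f g)) (interchange (f x) (g x) _ _)

Σ-*ˡ : ∀ (xs : List A) c f → Σ xs (λ x → c * f x) ≡ c * Σ xs f
Σ-*ˡ []       c f = sym (*-zeroʳ c)
Σ-*ˡ (x ∷ xs) c f = trans (cong (c * f x +_) (Σ-*ˡ xs c f)) (sym (*-distribˡ-+ c (f x) _))

Σ-*ʳ : ∀ (xs : List A) f c → Σ xs (λ x → f x * c) ≡ Σ xs f * c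
Σ-*ʳ xs f c = trans (Σ-cong xs (λ x → *-comm (f x) c)) (trans (Σ-*ˡ xs c f) (*-comm c _))

Σ-swap : ∀ (xs : List A) (ys : List B) (f : A → B → ℚ) →
         Σ xs (λ x → Σ ys (f x)) ≡ Σ ys (λ y → Σ xs (λ x → f x y))
Σ-swap []       ys f = sym (Σ-zero ys)
Σ-swap (x ∷ xs) ys f = trans (cong (Σ ys (f x) +_) (Σ-swap xs ys f)) (sym (Σ-+ ys (f x) (λ y → Σ xs (λ x → f x y))))

Σ-cartesianProductWith : ∀ {C : Set} (g : A → B → C) xs ys f →
  Σ (cartesianProductWith g xs ys) f ≡ Σ xs (λ x → Σ ys (λ y → f (g x y)))
Σ-cartesianProductWith g []       ys f = refl
Σ-cartesianProductWith g (x ∷ xs) ys f = trans (Σ-++ (map (g x) ys) _ f)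
  (cong₂ _+_ (Σ-map (g x) ys f) (Σ-cartesianProductWith g xs ys f))

Σ-* : ∀ (xs : List A) (ys : List B) f g → Σ xs (λ x → Σ ys (λ y → f x * g y)) ≡ Σ xs f * Σ ys g
Σ-* xs ys f g = trans (Σ-cong xs (λ x → Σ-*ˡ ys (f x) g)) (Σ-*ʳ xs f (Σ ys g))

𝟙 : {P : Set} → Dec P → ℚ
𝟙 p? = if does p? then 1ℚ else 0ℚ

𝟙-⇔ : ∀ {P Q : Set} → P ⇔ Q → (p? : Dec P) (q? : Dec Q) → 𝟙 p? ≡ 𝟙 q?
𝟙-⇔ P⇔Q p? q? = cong (if_then 1ℚ else 0ℚ) (does-⇔ P⇔Q p? q?)

𝟙-no : ∀ {P : Set} (p? : Dec P) → ¬ P → 𝟙 p? ≡ 0ℚ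
𝟙-no p? ¬p = cong (if_then 1ℚ else 0ℚ) (dec-false p? ¬p)

𝟙-× : ∀ {P Q : Set} (p? : Dec P) (q? : Dec Q) → 𝟙 (p? ×-dec q?) ≡ 𝟙 p? * 𝟙 q?
𝟙-× p? q? with does p?
... | true  = sym (*-identityˡ _)
... | false = sym (*-zeroˡ (𝟙 q?))

fromℕ-length-filter : ∀ {P : A → Set} (P? : Decidable P) xs → fromℕ (length (filter P? xs)) ≡ Σ xs (𝟙 ∘ P?)
fromℕ-length-filter P? []       = refl
fromℕ-length-filter P? (x ∷ xs) with does (P? x)
... | true  = trans (fromℕ-suc (length (filter P? xs))) (cong (1ℚ +_) (fromℕ-length-filter P? xs))
... | false = trans (fromℕ-length-filter P? xs) (sym (+-identityˡ _))

-- The sum of h i r over i + r = n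
∑₊ : ℕ → (ℕ → ℕ → ℚ) → ℚ
∑₊ zero    h = h 0 0
∑₊ (suc n) h = h 0 (suc n) + ∑₊ n (h ∘ suc)

∑₊-cong : ∀ n {h h′ : ℕ → ℕ → ℚ} → (∀ i r → i ℕ.+ r ≡ n → h i r ≡ h′ i r) → ∑₊ n h ≡ ∑₊ n h′
∑₊-cong zero    eq = eq 0 0 refl
∑₊-cong (suc n) eq = cong₂ _+_ (eq 0 (suc n) refl) (∑₊-cong n (λ i r i+r → eq (suc i) r (cong suc i+r)))

∑₊-zero : ∀ n → ∑₊ n (λ _ _ → 0ℚ) ≡ 0ℚ
∑₊-zero zero    = refl
∑₊-zero (suc n) = trans (+-identityˡ _) (∑₊-zero n)

∑₊-+ : ∀ n h h′ → ∑₊ n (λ i r → h i r + h′ i r) ≡ ∑₊ n h + ∑₊ n h′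
∑₊-+ zero    h h′ = refl
∑₊-+ (suc n) h h′ = trans (cong ((h 0 (suc n) + h′ 0 (suc n)) +_) (∑₊-+ n (h ∘ suc) (h′ ∘ suc)))
  (interchange (h 0 (suc n)) (h′ 0 (suc n)) _ _)

∑₊-*ˡ : ∀ n c h → ∑₊ n (λ i r → c * h i r) ≡ c * ∑₊ n h
∑₊-*ˡ zero    c h = refl
∑₊-*ˡ (suc n) c h = trans (cong (c * h 0 (suc n) +_) (∑₊-*ˡ n c (h ∘ suc))) (sym (*-distribˡ-+ c _ _))

∑₊-last : ∀ n h → ∑₊ (suc n) h ≡ ∑₊ n (λ i r → h i (suc r)) + h (suc n) 0
∑₊-last zero    h = refl
∑₊-last (suc n) h = trans (cong (h 0 (suc (suc n)) +_) (∑₊-last n (h ∘ suc))) (sym (+-assoc (h 0 (suc (suc n))) _ _))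

∑₊-Σ-swap : ∀ n (xs : List A) (h : ℕ → ℕ → A → ℚ) →
            ∑₊ n (λ i r → Σ xs (h i r)) ≡ Σ xs (λ x → ∑₊ n (λ i r → h i r x))
∑₊-Σ-swap zero    xs h = refl
∑₊-Σ-swap (suc n) xs h = trans (cong (Σ xs (h 0 (suc n)) +_) (∑₊-Σ-swap n xs (h ∘ suc))) (sym (Σ-+ xs _ _))

-- Only j = a, s = b can contribute, and this pair is in range exactly when a + b = k. A condition
-- on a total size thereby becomes a convolution.
𝟙-∑₊ : ∀ a b k → 𝟙 (a ℕ.+ b ≟ⁿ k) ≡ ∑₊ k (λ j s → 𝟙 (a ≟ⁿ j) * 𝟙 (b ≟ⁿ s))
𝟙-∑₊ zero    b zero    = sym (*-identityˡ _)
𝟙-∑₊ (suc a) b zero    = sym (*-zeroˡ (𝟙 (b ≟ⁿ 0)))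
𝟙-∑₊ zero    b (suc k) = sym (begin
  1ℚ * 𝟙 (b ≟ⁿ suc k) + ∑₊ k (λ j s → 0ℚ * 𝟙 (b ≟ⁿ s))
    ≡⟨ cong₂ _+_ (*-identityˡ (𝟙 (b ≟ⁿ suc k))) (trans (∑₊-cong k (λ j s _ → *-zeroˡ (𝟙 (b ≟ⁿ s)))) (∑₊-zero k)) ⟩
  𝟙 (b ≟ⁿ suc k) + 0ℚ   ≡⟨ +-identityʳ _ ⟩
  𝟙 (b ≟ⁿ suc k) ∎)
𝟙-∑₊ (suc a) b (suc k) = begin
  𝟙 (suc (a ℕ.+ b) ≟ⁿ suc k)
    ≡⟨ 𝟙-⇔ (mk⇔ ℕ.suc-injective (cong suc)) (suc (a ℕ.+ b) ≟ⁿ suc k) (a ℕ.+ b ≟ⁿ k) ⟩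
  𝟙 (a ℕ.+ b ≟ⁿ k) ≡⟨ 𝟙-∑₊ a b k ⟩
  ∑₊ k (λ j s → 𝟙 (a ≟ⁿ j) * 𝟙 (b ≟ⁿ s))
    ≡⟨ ∑₊-cong k (λ j s _ → cong (_* 𝟙 (b ≟ⁿ s)) (𝟙-⇔ (mk⇔ (cong suc) ℕ.suc-injective) (a ≟ⁿ j) (suc a ≟ⁿ suc j))) ⟩
  ∑₊ k (λ j s → 𝟙 (suc a ≟ⁿ suc j) * 𝟙 (b ≟ⁿ s)) ≡⟨ +-identityˡ _ ⟨
  0ℚ + ∑₊ k (λ j s → 𝟙 (suc a ≟ⁿ suc j) * 𝟙 (b ≟ⁿ s))
    ≡⟨ cong (_+ ∑₊ k (λ j s → 𝟙 (suc a ≟ⁿ suc j) * 𝟙 (b ≟ⁿ s))) (*-zeroˡ (𝟙 (b ≟ⁿ suc k))) ⟨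
  0ℚ * 𝟙 (b ≟ⁿ suc k) + ∑₊ k (λ j s → 𝟙 (suc a ≟ⁿ suc j) * 𝟙 (b ≟ⁿ s)) ∎

-- The product rule for x d/dx in terms of coefficients: in each summand n is split as i + r.
∑₊-degree : ∀ n h → fromℕ n * ∑₊ n h ≡ ∑₊ n (λ i r → fromℕ i * h i r) + ∑₊ n (λ i r → fromℕ r * h i r)
∑₊-degree n h = begin
  fromℕ n * ∑₊ n h ≡⟨ ∑₊-*ˡ n (fromℕ n) h ⟨
  ∑₊ n (λ i r → fromℕ n * h i r) ≡⟨ ∑₊-cong n split ⟩
  ∑₊ n (λ i r → fromℕ i * h i r + fromℕ r * h i r) ≡⟨ ∑₊-+ n _ _ ⟩
  _ ∎
  where
  split : ∀ i r → i ℕ.+ r ≡ n → fromℕ n * h i r ≡ fromℕ i * h i r + fromℕ r * h i r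
  split i r refl = trans (cong (_* h i r) (fromℕ-+ i r)) (*-distribʳ-+ (h i r) (fromℕ i) (fromℕ r))

-- Grouping by cardinality: n!/(i! r!) subsets have i elements. No binomial coefficient appears;
-- deciding whether the first vertex belongs to `C` plays the role of Pascal's rule, and after
-- multiplication by n + 1 the two cases match the two halves of `∑₊-degree`.
Σ-subsets : ∀ n (g : ℕ → ℕ → ℚ) →
  Σ (allSubsets n) (λ C → g ∣ C ∣ ∣ ∁ C ∣) * 1/ n ! ≡ ∑₊ n (λ i r → 1/ i ! * 1/ r ! * g i r)
Σ-subsets zero    g = trans (*-identityʳ (g 0 0 + 0ℚ)) (trans (+-identityʳ (g 0 0)) (sym (*-identityˡ (g 0 0))))
Σ-subsets (suc n) g = *-cancelˡ-suc n (begin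
  fromℕ (suc n) * (Σ (allSubsets (suc n)) (λ C → g ∣ C ∣ ∣ ∁ C ∣) * 1/ suc n !)
    ≡⟨ solve 3 (λ a b c → a :* (b :* c) := b :* (a :* c)) refl (fromℕ (suc n))
         (Σ (allSubsets (suc n)) (λ C → g ∣ C ∣ ∣ ∁ C ∣)) (1/ suc n !) ⟩
  Σ (allSubsets (suc n)) (λ C → g ∣ C ∣ ∣ ∁ C ∣) * (fromℕ (suc n) * 1/ suc n !)
    ≡⟨ cong₂ _*_ (trans (Σ-cartesianProductWith _∷_ (true ∷ false ∷ []) (allSubsets n) (λ C → g ∣ C ∣ ∣ ∁ C ∣))
         (cong (S₁ +_) (+-identityʳ S₂))) (suc*1/! n) ⟩
  (S₁ + S₂) * 1/ n ! ≡⟨ *-distribʳ-+ (1/ n !) S₁ S₂ ⟩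
  S₁ * 1/ n ! + S₂ * 1/ n !
    ≡⟨ cong₂ _+_ (Σ-subsets n (λ i r → g (suc i) r)) (Σ-subsets n (λ i r → g i (suc r))) ⟩
  ∑₊ n (λ i r → 1/ i ! * 1/ r ! * g (suc i) r) + ∑₊ n (λ i r → 1/ i ! * 1/ r ! * g i (suc r))
    ≡⟨ cong₂ _+_ first last ⟩
  ∑₊ (suc n) (λ i r → fromℕ i * h i r) + ∑₊ (suc n) (λ i r → fromℕ r * h i r)
    ≡⟨ ∑₊-degree (suc n) h ⟨
  fromℕ (suc n) * ∑₊ (suc n) h ∎)
  where
  open +-*-Solver
  h : ℕ → ℕ → ℚ
  h i r = 1/ i ! * 1/ r ! * g i r

  S₁ = Σ (allSubsets n) (λ C → g (suc ∣ C ∣) ∣ ∁ C ∣)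
  S₂ = Σ (allSubsets n) (λ C → g ∣ C ∣ (suc ∣ ∁ C ∣))

  -- Here i/i! = 1/(i-1)! shifts the index, and the extra summand i = 0 carries the factor 0; `last`
  -- does the same with r.
  first : ∑₊ n (λ i r → 1/ i ! * 1/ r ! * g (suc i) r) ≡ ∑₊ (suc n) (λ i r → fromℕ i * h i r)
  first = begin
    ∑₊ n (λ i r → 1/ i ! * 1/ r ! * g (suc i) r)
      ≡⟨ ∑₊-cong n (λ i r _ → trans (cong (λ w → w * 1/ r ! * g (suc i) r) (sym (suc*1/! i)))
           (solve 4 (λ a b c d → a :* b :* c :* d := a :* (b :* c :* d)) refl
             (fromℕ (suc i)) (1/ suc i !) (1/ r !) (g (suc i) r))) ⟩
    ∑₊ n (λ i r → fromℕ (suc i) * h (suc i) r) ≡⟨ +-identityˡ _ ⟨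
    0ℚ + ∑₊ n (λ i r → fromℕ (suc i) * h (suc i) r)
      ≡⟨ cong (_+ ∑₊ n (λ i r → fromℕ (suc i) * h (suc i) r)) (*-zeroˡ (h 0 (suc n))) ⟨
    ∑₊ (suc n) (λ i r → fromℕ i * h i r) ∎

  last : ∑₊ n (λ i r → 1/ i ! * 1/ r ! * g i (suc r)) ≡ ∑₊ (suc n) (λ i r → fromℕ r * h i r)
  last = begin
    ∑₊ n (λ i r → 1/ i ! * 1/ r ! * g i (suc r))
      ≡⟨ ∑₊-cong n (λ i r _ → trans (cong (λ w → 1/ i ! * w * g i (suc r)) (sym (suc*1/! r)))
           (solve 4 (λ a b c d → c :* (a :* b) :* d := a :* (c :* b :* d)) refl
             (fromℕ (suc r)) (1/ suc r !) (1/ i !) (g i (suc r)))) ⟩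
    ∑₊ n (λ i r → fromℕ (suc r) * h i (suc r)) ≡⟨ +-identityʳ _ ⟨
    ∑₊ n (λ i r → fromℕ (suc r) * h i (suc r)) + 0ℚ
      ≡⟨ cong (∑₊ n (λ i r → fromℕ (suc r) * h i (suc r)) +_) (*-zeroˡ (h (suc n) 0)) ⟨
    ∑₊ n (λ i r → fromℕ (suc r) * h i (suc r)) + 0ℚ * h (suc n) 0
      ≡⟨ ∑₊-last n (λ i r → fromℕ r * h i r) ⟨
    ∑₊ (suc n) (λ i r → fromℕ r * h i r) ∎

-- Counting graphs

-- The product rule for generating functions: when a statistic is additive over pairs, the weighted
-- counts by its value are convolved.
Σ-convolution : ∀ (xs : List A) (ys : List B) (f : A → ℚ) (g : B → ℚ) (s : A → ℕ) (t : B → ℕ) k →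
  Σ xs (λ x → Σ ys (λ y → f x * g y * 𝟙 (s x ℕ.+ t y ≟ⁿ k))) ≡
  ∑₊ k (λ i j → Σ xs (λ x → f x * 𝟙 (s x ≟ⁿ i)) * Σ ys (λ y → g y * 𝟙 (t y ≟ⁿ j)))
Σ-convolution xs ys f g s t k = begin
  Σ xs (λ x → Σ ys (λ y → f x * g y * 𝟙 (s x ℕ.+ t y ≟ⁿ k)))
    ≡⟨ Σ-cong xs (λ x → Σ-cong ys (expand x)) ⟩
  Σ xs (λ x → Σ ys (λ y → ∑₊ k (λ i j → F i x * G j y)))
    ≡⟨ Σ-cong xs (λ x → ∑₊-Σ-swap k ys (λ i j y → F i x * G j y)) ⟨
  Σ xs (λ x → ∑₊ k (λ i j → Σ ys (λ y → F i x * G j y)))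
    ≡⟨ ∑₊-Σ-swap k xs (λ i j x → Σ ys (λ y → F i x * G j y)) ⟨
  ∑₊ k (λ i j → Σ xs (λ x → Σ ys (λ y → F i x * G j y)))
    ≡⟨ ∑₊-cong k (λ i j _ → Σ-* xs ys (F i) (G j)) ⟩
  ∑₊ k (λ i j → Σ xs (F i) * Σ ys (G j)) ∎
  where
  open +-*-Solver
  F = λ i x → f x * 𝟙 (s x ≟ⁿ i)
  G = λ j y → g y * 𝟙 (t y ≟ⁿ j)

  expand : ∀ x y → f x * g y * 𝟙 (s x ℕ.+ t y ≟ⁿ k) ≡ ∑₊ k (λ i j → F i x * G j y)
  expand x y = begin
    f x * g y * 𝟙 (s x ℕ.+ t y ≟ⁿ k)
      ≡⟨ cong (f x * g y *_) (𝟙-∑₊ (s x) (t y) k) ⟩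
    f x * g y * ∑₊ k (λ i j → 𝟙 (s x ≟ⁿ i) * 𝟙 (t y ≟ⁿ j)) ≡⟨ ∑₊-*ˡ k (f x * g y) _ ⟨
    ∑₊ k (λ i j → f x * g y * (𝟙 (s x ≟ⁿ i) * 𝟙 (t y ≟ⁿ j)))
      ≡⟨ ∑₊-cong k (λ i j _ → solve 4 (λ a b c d → a :* b :* (c :* d) := (a :* c) :* (b :* d)) refl
           (f x) (g y) (𝟙 (s x ≟ⁿ i)) (𝟙 (t y ≟ⁿ j))) ⟩
    ∑₊ k (λ i j → F i x * G j y) ∎

*-𝟙 : ∀ {P : Set} (p? : Dec P) {p q} → (P → p ≡ q) → p * 𝟙 p? ≡ 𝟙 p? * q
*-𝟙 (yes x) {p}     eq = trans (*-comm p 1ℚ) (cong (1ℚ *_) (eq x))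
*-𝟙 (no _)  {p} {q} eq = trans (*-zeroʳ p) (sym (*-zeroˡ q))

b̄ : ℕ → ℕ → ℚ
b̄ n k = fromℕ (#connectedBipartite n k)

b : ℕ → ℕ → ℕ → ℚ
b n k ν = fromℕ (#bipartite n k ν)

-- Counts the pairs of a connected bipartite graph of order i and a bipartite graph of order r with
-- ν components, with k edges in all. It depends on a subset only through the two cardinalities, as
-- `Σ-subsets` requires.
b̄⊛b : ℕ → ℕ → ℕ → ℕ → ℚ
b̄⊛b k ν i r = ∑₊ k (λ j s → b̄ i j * b r s ν)

-- `union C` is a bijection from pairs of graphs onto the graphs counted here: sizes add, and
-- removing `C` lowers the number of components by one. For empty `C` both sides are 0, as
-- components are nonempty and the graph without vertices is not connected.
count-with-component : ∀ (C : Subset n) k ν →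
  Σ (allMatrices n) (λ G →
    𝟙 (isSimpleGraph? G ×-dec (bipartite? G ×-dec ((size G ≟ⁿ k) ×-dec (components G ≟ⁿ suc ν)))) *
    𝟙 (isComponent? G C))
  ≡ b̄⊛b k ν ∣ C ∣ ∣ ∁ C ∣
count-with-component {n} C k ν = begin
  Σ (allMatrices n) (λ G → 𝟙 (P? G) * 𝟙 (isComponent? G C))
    ≡⟨ Σ-cong (allMatrices n) (λ G → 𝟙-× (P? G) (isComponent? G C)) ⟨
  Σ (allMatrices n) (𝟙 ∘ PC?)
    ≡⟨ fromℕ-length-filter PC? (allMatrices n) ⟨
  fromℕ (length (filter PC? (allMatrices n)))
    ≡⟨ cong fromℕ (trans (length-cong whole! parts! (mk⇔ ⇒ ⇐)) (length-map (union C) (filter Q? pairs))) ⟩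
  fromℕ (length (filter Q? pairs))
    ≡⟨ fromℕ-length-filter Q? pairs ⟩
  Σ pairs (𝟙 ∘ Q?)
    ≡⟨ Σ-cartesianProductWith _,_ (allMatrices ∣ C ∣) (allMatrices ∣ ∁ C ∣) (𝟙 ∘ Q?) ⟩
  Σ (allMatrices ∣ C ∣) (λ H → Σ (allMatrices ∣ ∁ C ∣) (λ K → 𝟙 (Q? (H , K))))
    ≡⟨ Σ-cong (allMatrices ∣ C ∣) (λ H → Σ-cong (allMatrices ∣ ∁ C ∣) (λ K →
         trans (𝟙-× (H? H ×-dec K? K) (size H ℕ.+ size K ≟ⁿ k))
               (cong (_* 𝟙 (size H ℕ.+ size K ≟ⁿ k)) (𝟙-× (H? H) (K? K))))) ⟩
  Σ (allMatrices ∣ C ∣) (λ H → Σ (allMatrices ∣ ∁ C ∣) (λ K → 𝟙 (H? H) * 𝟙 (K? K) * 𝟙 (size H ℕ.+ size K ≟ⁿ k)))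
    ≡⟨ Σ-convolution (allMatrices ∣ C ∣) (allMatrices ∣ ∁ C ∣) (𝟙 ∘ H?) (𝟙 ∘ K?) size size k ⟩
  ∑₊ k (λ j s → Σ (allMatrices ∣ C ∣) (λ H → 𝟙 (H? H) * 𝟙 (size H ≟ⁿ j)) *
                Σ (allMatrices ∣ ∁ C ∣) (λ K → 𝟙 (K? K) * 𝟙 (size K ≟ⁿ s)))
    ≡⟨ ∑₊-cong k (λ j s _ → cong₂ _*_ (count-H j) (count-K s)) ⟩
  b̄⊛b k ν ∣ C ∣ ∣ ∁ C ∣ ∎
  where
  P? : ∀ G → Dec _
  P? G = isSimpleGraph? G ×-dec (bipartite? G ×-dec ((size G ≟ⁿ k) ×-dec (components G ≟ⁿ suc ν)))

  PC? : ∀ G → Dec _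
  PC? G = P? G ×-dec isComponent? G C

  -- Sizes are kept out of `H?` and `K?`: only their sum is prescribed, and the convolution
  -- distributes it over the two parts.
  H? : ∀ H → Dec _
  H? H = isSimpleGraph? {∣ C ∣} H ×-dec (connected? H ×-dec bipartite? H)

  K? : ∀ K → Dec _
  K? K = isSimpleGraph? {∣ ∁ C ∣} K ×-dec (bipartite? K ×-dec (components K ≟ⁿ ν))

  Q? : Decidable _
  Q? (H , K) = (H? H ×-dec K? K) ×-dec (size H ℕ.+ size K ≟ⁿ k)

  pairs : List (Matrix ∣ C ∣ × Matrix ∣ ∁ C ∣)
  pairs = cartesianProduct (allMatrices ∣ C ∣) (allMatrices ∣ ∁ C ∣)

  whole! = Unique.filter⁺ PC? (allMatrices-unique n)

  parts! = Unique.map⁺ (union-injective C)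
    (Unique.filter⁺ Q? (Unique.cartesianProduct⁺ (allMatrices-unique ∣ C ∣) (allMatrices-unique ∣ ∁ C ∣)))

  ⇒ : ∀ {G} → G ∈ˡ filter PC? (allMatrices n) → G ∈ˡ map (union C) (filter Q? pairs)
  ⇒ {G} p with _ , (simple , bip , size≡ , comp≡) , comp ← ∈-filter⁻ PC? {xs = allMatrices n} p =
    subst (_∈ˡ map (union C) (filter Q? pairs)) (union-unique union-isUnion U)
      (∈-map⁺ (union C) (∈-filter⁺ Q? (∈-cartesianProduct⁺ (∈-allMatrices H) (∈-allMatrices K))
        (((proj₁ simples , conn , proj₁ bips) ,
          (proj₂ simples , proj₂ bips , ℕ.suc-injective (trans (sym (components-union U conn)) comp≡))) ,
         trans (sym (size-union U)) size≡)))
    where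
    H = restrict C G
    K = restrict (∁ C) G
    U : IsUnion C G H K
    U = component⇒isUnion simple comp
    simples = to (simple⇔ U) simple
    bips = to (bipartite⇔ U) bip
    conn = to (connected⇔ U simple) comp

  ⇐ : ∀ {G} → G ∈ˡ map (union C) (filter Q? pairs) → G ∈ˡ filter PC? (allMatrices n)
  ⇐ p with (H , K) , q , refl ← ∈-map⁻ (union C) p
      with _ , ((simpleH , conn , bipH) , (simpleK , bipK , compK)) , size≡ ← ∈-filter⁻ Q? {xs = pairs} q =
    ∈-filter⁺ PC? (∈-allMatrices _)
      ((simple , from (bipartite⇔ U) (bipH , bipK) , trans (size-union U) size≡ ,
        trans (components-union U conn) (cong suc compK)) ,
       from (connected⇔ U simple) conn)
    where
    U = union-isUnion {C = C} {H} {K}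
    simple = from (simple⇔ U) (simpleH , simpleK)

  count-H : ∀ j → Σ (allMatrices ∣ C ∣) (λ H → 𝟙 (H? H) * 𝟙 (size H ≟ⁿ j)) ≡ b̄ ∣ C ∣ j
  count-H j = sym (trans (fromℕ-length-filter R? (allMatrices ∣ C ∣)) (Σ-cong (allMatrices ∣ C ∣) λ H →
    trans (𝟙-⇔ (mk⇔ (λ (s , c , b , e) → (s , c , b) , e) (λ ((s , c , b) , e) → s , c , b , e))
               (R? H) (H? H ×-dec (size H ≟ⁿ j)))
          (𝟙-× (H? H) (size H ≟ⁿ j))))
    where
    R? : ∀ H → Dec _
    R? H = isSimpleGraph? H ×-dec (connected? H ×-dec (bipartite? H ×-dec (size H ≟ⁿ j)))

  count-K : ∀ s → Σ (allMatrices ∣ ∁ C ∣) (λ K → 𝟙 (K? K) * 𝟙 (size K ≟ⁿ s)) ≡ b ∣ ∁ C ∣ s ν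
  count-K s = sym (trans (fromℕ-length-filter R? (allMatrices ∣ ∁ C ∣)) (Σ-cong (allMatrices ∣ ∁ C ∣) λ K →
    trans (𝟙-⇔ (mk⇔ (λ (s , b , e , c) → (s , b , c) , e) (λ ((s , b , c) , e) → s , b , e , c))
               (R? K) (K? K ×-dec (size K ≟ⁿ s)))
          (𝟙-× (K? K) (size K ≟ⁿ s))))
    where
    R? : ∀ K → Dec _
    R? K = isSimpleGraph? K ×-dec (bipartite? K ×-dec ((size K ≟ⁿ s) ×-dec (components K ≟ⁿ ν)))

b-recurrence : ∀ n k ν →
  fromℕ (suc ν) * b n k (suc ν) ≡
  Σ (allSubsets n) (λ C → b̄⊛b k ν ∣ C ∣ ∣ ∁ C ∣)
b-recurrence n k ν = begin
  fromℕ (suc ν) * b n k (suc ν)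
    ≡⟨ cong (fromℕ (suc ν) *_) (fromℕ-length-filter P? (allMatrices n)) ⟩
  fromℕ (suc ν) * Σ (allMatrices n) (𝟙 ∘ P?)
    ≡⟨ Σ-*ˡ (allMatrices n) (fromℕ (suc ν)) (𝟙 ∘ P?) ⟨
  Σ (allMatrices n) (λ G → fromℕ (suc ν) * 𝟙 (P? G))
    ≡⟨ Σ-cong (allMatrices n) choose ⟩
  Σ (allMatrices n) (λ G → Σ (allSubsets n) (λ C → 𝟙 (P? G) * 𝟙 (isComponent? G C)))
    ≡⟨ Σ-swap (allMatrices n) (allSubsets n) (λ G C → 𝟙 (P? G) * 𝟙 (isComponent? G C)) ⟩
  Σ (allSubsets n) (λ C → Σ (allMatrices n) (λ G → 𝟙 (P? G) * 𝟙 (isComponent? G C)))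
    ≡⟨ Σ-cong (allSubsets n) (λ C → count-with-component C k ν) ⟩
  Σ (allSubsets n) (λ C → b̄⊛b k ν ∣ C ∣ ∣ ∁ C ∣) ∎
  where
  P? : ∀ G → Dec _
  P? G = isSimpleGraph? G ×-dec (bipartite? G ×-dec ((size G ≟ⁿ k) ×-dec (components G ≟ⁿ suc ν)))

  choose : ∀ G → fromℕ (suc ν) * 𝟙 (P? G) ≡ Σ (allSubsets n) (λ C → 𝟙 (P? G) * 𝟙 (isComponent? G C))
  choose G = begin
    fromℕ (suc ν) * 𝟙 (P? G)
      -- Wherever the indicator is 1, the constant ν + 1 is the number of components of `G`, that
      -- is, the number of choices of `C`.
      ≡⟨ *-𝟙 (P? G) (λ (_ , _ , _ , eq) → cong fromℕ (sym eq)) ⟩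
    𝟙 (P? G) * fromℕ (components G)
      ≡⟨ cong (𝟙 (P? G) *_) (fromℕ-length-filter (isComponent? G) (allSubsets n)) ⟩
    𝟙 (P? G) * Σ (allSubsets n) (𝟙 ∘ isComponent? G)
      ≡⟨ Σ-*ˡ (allSubsets n) (𝟙 (P? G)) (𝟙 ∘ isComponent? G) ⟨
    Σ (allSubsets n) (λ C → 𝟙 (P? G) * 𝟙 (isComponent? G C))   ∎

b-recurrence-! : ∀ n k ν →
  fromℕ (suc ν) * (b n k (suc ν) * 1/ n !) ≡
  ∑₊ n (λ i r → ∑₊ k (λ j s → (b̄ i j * 1/ i !) * (b r s ν * 1/ r !)))
b-recurrence-! n k ν = begin
  fromℕ (suc ν) * (b n k (suc ν) * 1/ n !) ≡⟨ *-assoc (fromℕ (suc ν)) (b n k (suc ν)) (1/ n !) ⟨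
  fromℕ (suc ν) * b n k (suc ν) * 1/ n ! ≡⟨ cong (_* 1/ n !) (b-recurrence n k ν) ⟩
  Σ (allSubsets n) (λ C → b̄⊛b k ν ∣ C ∣ ∣ ∁ C ∣) * 1/ n !   ≡⟨ Σ-subsets n (b̄⊛b k ν) ⟩
  ∑₊ n (λ i r → 1/ i ! * 1/ r ! * b̄⊛b k ν i r)
    ≡⟨ ∑₊-cong n (λ i r _ → trans (sym (∑₊-*ˡ k (1/ i ! * 1/ r !) (λ j s → b̄ i j * b r s ν)))
         (∑₊-cong k (λ j s _ → solve 4 (λ u v x y → u :* v :* (x :* y) := (x :* u) :* (y :* v)) refl
           (1/ i !) (1/ r !) (b̄ i j) (b r s ν)))) ⟩
  ∑₊ n (λ i r → ∑₊ k (λ j s → (b̄ i j * 1/ i !) * (b r s ν * 1/ r !))) ∎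
  where open +-*-Solver

components-nonzero : (G : Matrix (suc n)) → components G ≢ 0
components-nonzero {n} G eq = contradiction (∈-filter⁺ (isComponent? G) (∈-allSubsets C) C-component) (∉-empty eq)
  where
  C : Subset (suc n)
  C = comprehension (reachable? G Fin.zero)

  C-component : IsComponent G C
  C-component = Fin.zero , λ v → to (∈-comprehension (reachable? G Fin.zero) v) ,
                                 from (∈-comprehension (reachable? G Fin.zero) v)

  ∉-empty : ∀ {xs : List (Subset (suc n))} {x} → length xs ≡ 0 → ¬ (x ∈ˡ xs)
  ∉-empty {[]} _ ()

b-no-components : ∀ n k → b (suc n) k 0 ≡ 0ℚ
b-no-components n k = begin
  b (suc n) k 0 ≡⟨ fromℕ-length-filter P? (allMatrices (suc n)) ⟩
  Σ (allMatrices (suc n)) (𝟙 ∘ P?)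
    ≡⟨ Σ-cong (allMatrices (suc n)) (λ G → 𝟙-no (P? G) (λ (_ , _ , _ , eq) → components-nonzero G eq)) ⟩
  Σ (allMatrices (suc n)) (λ _ → 0ℚ) ≡⟨ Σ-zero (allMatrices (suc n)) ⟩
  0ℚ ∎
  where
  P? : ∀ G → Dec _
  P? G = isSimpleGraph? G ×-dec (bipartite? G ×-dec ((size G ≟ⁿ k) ×-dec (components G ≟ⁿ 0)))

-- Needed because `exp` stops at m = n. In the recurrence the summands with i = 0 are 0, and for i >
-- 0 the complement has order r < ν, so that induction applies.
b-vanishes : ∀ n k ν → n ℕ.< ν → b n k ν ≡ 0ℚ
b-vanishes n k (suc ν) (s≤s n≤ν) = *-cancelʳ-1/! n (*-cancelˡ-suc ν (begin
  fromℕ (suc ν) * (b n k (suc ν) * 1/ n !) ≡⟨ b-recurrence-! n k ν ⟩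
  ∑₊ n (λ i r → ∑₊ k (λ j s → (b̄ i j * 1/ i !) * (b r s ν * 1/ r !)))
    ≡⟨ ∑₊-cong n (λ i r i+r≡n → trans (∑₊-cong k (λ j s _ → term i r j s i+r≡n)) (∑₊-zero k)) ⟩
  ∑₊ n (λ _ _ → 0ℚ) ≡⟨ ∑₊-zero n ⟩
  0ℚ
    ≡⟨ *-zeroʳ (fromℕ (suc ν)) ⟨
  fromℕ (suc ν) * 0ℚ
    ≡⟨ cong (fromℕ (suc ν) *_) (*-zeroˡ (1/ n !)) ⟨
  fromℕ (suc ν) * (0ℚ * 1/ n !) ∎))
  where
  term : ∀ i r j s → i ℕ.+ r ≡ n → (b̄ i j * 1/ i !) * (b r s ν * 1/ r !) ≡ 0ℚ
  -- `b̄ 0 j` computes to 0, since the only graph of order 0 is not connected.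
  term zero    r j s _    = *-zeroˡ (b r s ν * 1/ r !)
  term (suc i) r j s refl = begin
    (b̄ (suc i) j * 1/ suc i !) * (b r s ν * 1/ r !)
      ≡⟨ cong (λ q → (b̄ (suc i) j * 1/ suc i !) * (q * 1/ r !))
           (b-vanishes r s ν (ℕ.≤-trans (s≤s (ℕ.m≤n+m r i)) n≤ν)) ⟩
    (b̄ (suc i) j * 1/ suc i !) * (0ℚ * 1/ r !)
      ≡⟨ cong ((b̄ (suc i) j * 1/ suc i !) *_) (*-zeroˡ (1/ r !)) ⟩
    (b̄ (suc i) j * 1/ suc i !) * 0ℚ ≡⟨ *-zeroʳ (b̄ (suc i) j * 1/ suc i !) ⟩
    0ℚ ∎

-- The coefficients of the powers of 𝓑

-- Stated for an arbitrary additive functional, as it serves both the total coefficient and the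
-- extraction of a power of z.
∑-additive : (φ : Poly → ℚ) → φ [] ≡ 0ℚ → (∀ p q → φ (p ++ q) ≡ φ p + φ q) →
             ∀ n f → φ (∑ n f) ≡ ∑₊ n (λ i _ → φ (f i))
∑-additive φ φ[] φ++ n f = go n id
  where
  -- `upTo` is `applyUpTo id`, whose recursion composes the function with `suc`; hence the induction
  -- over all `g`.
  go : ∀ n (g : ℕ → ℕ) → φ (concatMap f (applyUpTo g (suc n))) ≡ ∑₊ n (λ i _ → φ (f (g i)))
  go zero    g = trans (φ++ (f (g 0)) []) (trans (cong (φ (f (g 0)) +_) φ[]) (+-identityʳ (φ (f (g 0)))))
  go (suc n) g = trans (φ++ (f (g 0)) (concatMap f (applyUpTo (g ∘ suc) (suc n))))
    (cong (φ (f (g 0)) +_) (go n (g ∘ suc)))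

∑₊-∸ : ∀ n (h : ℕ → ℕ → ℚ) → ∑₊ n (λ i _ → h i (n ∸ i)) ≡ ∑₊ n h
∑₊-∸ n h = ∑₊-cong n λ { i r refl → cong (h i) (m+n∸m≡n i r) }

-- Evaluation with every variable set to 1, hence multiplicative as well as additive.
total : Poly → ℚ
total p = Σ p proj₁

total-∑ : ∀ n f → total (∑ n f) ≡ ∑₊ n (λ i _ → total (f i))
total-∑ = ∑-additive total refl (λ p q → Σ-++ p q proj₁)

total-*ᴾ : ∀ p q → total (p *ᴾ q) ≡ total p * total q
total-*ᴾ p q = trans (Σ-cartesianProductWith _ p q proj₁) (Σ-* p q proj₁ proj₁)

total-*ˢ : ∀ F G n k → total ((F *ˢ G) n k) ≡ ∑₊ n (λ i r → ∑₊ k (λ j s → total (F i j) * total (G r s)))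
total-*ˢ F G n k = begin
  total ((F *ˢ G) n k)
    ≡⟨ total-∑ n (λ i → ∑ k (λ j → F i j *ᴾ G (n ∸ i) (k ∸ j))) ⟩
  ∑₊ n (λ i _ → total (∑ k (λ j → F i j *ᴾ G (n ∸ i) (k ∸ j))))
    ≡⟨ ∑₊-cong n (λ i _ _ → total-∑ k (λ j → F i j *ᴾ G (n ∸ i) (k ∸ j))) ⟩
  ∑₊ n (λ i _ → ∑₊ k (λ j _ → total (F i j *ᴾ G (n ∸ i) (k ∸ j))))
    ≡⟨ ∑₊-∸ n (λ i r → ∑₊ k (λ j _ → total (F i j *ᴾ G r (k ∸ j)))) ⟩
  ∑₊ n (λ i r → ∑₊ k (λ j _ → total (F i j *ᴾ G r (k ∸ j))))
    ≡⟨ ∑₊-cong n (λ i r _ → ∑₊-∸ k (λ j s → total (F i j *ᴾ G r s))) ⟩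
  ∑₊ n (λ i r → ∑₊ k (λ j s → total (F i j *ᴾ G r s)))
    ≡⟨ ∑₊-cong n (λ i r _ → ∑₊-cong k (λ j s _ → total-*ᴾ (F i j) (G r s))) ⟩
  ∑₊ n (λ i r → ∑₊ k (λ j s → total (F i j) * total (G r s))) ∎

total-𝓑 : ∀ n k → total (𝓑 n k) ≡ b̄ n k * 1/ n !
total-𝓑 zero    k = refl
total-𝓑 (suc n) k = +-identityʳ (b̄ (suc n) k * 1/ suc n !)

-- The graph without vertices is the only one with no component; it accounts for the constant term
-- 1.
total-1ˢ : ∀ n k → total (1ˢ n k) ≡ b n k 0 * 1/ n !
total-1ˢ zero    zero    = refl
total-1ˢ zero    (suc k) = refl
total-1ˢ (suc n) k       = sym (trans (cong (_* 1/ suc n !) (b-no-components n k)) (*-zeroˡ (1/ suc n !)))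

-- Both sides obey the same recurrence in m: the factor m + 1 lowers 1/(m+1)! to 1/m!, which is then
-- absorbed by the induction hypothesis for the factor `𝓑 ^ˢ m`.
total-𝓑^ : ∀ m n k → 1/ m ! * total ((𝓑 ^ˢ m) n k) ≡ b n k m * 1/ n !
total-𝓑^ zero    n k = trans (*-identityˡ (total (1ˢ n k))) (total-1ˢ n k)
total-𝓑^ (suc m) n k = *-cancelˡ-suc m (begin
  fromℕ (suc m) * (1/ suc m ! * total ((𝓑 *ˢ (𝓑 ^ˢ m)) n k))
    ≡⟨ *-assoc (fromℕ (suc m)) (1/ suc m !) _ ⟨
  fromℕ (suc m) * 1/ suc m ! * total ((𝓑 *ˢ (𝓑 ^ˢ m)) n k)
    ≡⟨ cong₂ _*_ (suc*1/! m) (total-*ˢ 𝓑 (𝓑 ^ˢ m) n k) ⟩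
  1/ m ! * ∑₊ n (λ i r → ∑₊ k (λ j s → total (𝓑 i j) * total ((𝓑 ^ˢ m) r s)))
    ≡⟨ ∑₊-*ˡ n (1/ m !) _ ⟨
  ∑₊ n (λ i r → 1/ m ! * ∑₊ k (λ j s → total (𝓑 i j) * total ((𝓑 ^ˢ m) r s)))
    ≡⟨ ∑₊-cong n (λ i r _ → ∑₊-*ˡ k (1/ m !) (λ j s → total (𝓑 i j) * total ((𝓑 ^ˢ m) r s))) ⟨
  ∑₊ n (λ i r → ∑₊ k (λ j s → 1/ m ! * (total (𝓑 i j) * total ((𝓑 ^ˢ m) r s))))
    ≡⟨ ∑₊-cong n (λ i r _ → ∑₊-cong k (λ j s _ → term i r j s)) ⟩
  ∑₊ n (λ i r → ∑₊ k (λ j s → (b̄ i j * 1/ i !) * (b r s m * 1/ r !)))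
    ≡⟨ b-recurrence-! n k m ⟨
  fromℕ (suc m) * (b n k (suc m) * 1/ n !) ∎)
  where
  open +-*-Solver
  term : ∀ i r j s → 1/ m ! * (total (𝓑 i j) * total ((𝓑 ^ˢ m) r s)) ≡ (b̄ i j * 1/ i !) * (b r s m * 1/ r !)
  term i r j s = trans
    (solve 3 (λ x y z → x :* (y :* z) := y :* (x :* z)) refl (1/ m !) (total (𝓑 i j)) (total ((𝓑 ^ˢ m) r s)))
    (cong₂ _*_ (total-𝓑 i j) (total-𝓑^ m r s))

-- Homogeneity and the extraction of a power of z

degree : Monomial → ℚ
degree = weight (λ _ → 1ℚ)

degree-∙ : ∀ α β → degree (α ∙ β) ≡ degree α + degree β
degree-∙ []      β       = sym (+-identityˡ (degree β))
degree-∙ (a ∷ α) []      = sym (+-identityʳ (degree (a ∷ α)))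
degree-∙ (x ∷ α) (y ∷ β) = begin
  1ℚ * fromℕ (x ℕ.+ y) + degree (α ∙ β)
    ≡⟨ cong₂ _+_ (trans (cong (1ℚ *_) (fromℕ-+ x y)) (*-distribˡ-+ 1ℚ (fromℕ x) (fromℕ y))) (degree-∙ α β) ⟩
  (1ℚ * fromℕ x + 1ℚ * fromℕ y) + (degree α + degree β)
    ≡⟨ interchange (1ℚ * fromℕ x) (1ℚ * fromℕ y) (degree α) (degree β) ⟩
  (1ℚ * fromℕ x + degree α) + (1ℚ * fromℕ y + degree β) ∎

degree-z : ∀ n → degree (z n) ≡ 1ℚ
degree-z zero    = refl
degree-z (suc n) = trans (+-identityˡ (degree (z n))) (degree-z n)

Homogeneous : ℕ → Poly → Set
Homogeneous m = All (λ (_ , α) → degree α ≡ fromℕ m)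

homogeneous-∑ : ∀ m n {f} → (∀ i → Homogeneous m (f i)) → Homogeneous m (∑ n f)
homogeneous-∑ m n hom = All.concat⁺ (All.map⁺ (All.universal hom (upTo (suc n))))

homogeneous-*ᴾ : ∀ l m {p q} → Homogeneous l p → Homogeneous m q → Homogeneous (l ℕ.+ m) (p *ᴾ q)
homogeneous-*ᴾ l m []                     hq = []
homogeneous-*ᴾ l m {(_ , α) ∷ p} (hα ∷ hp) hq = All.++⁺
  (All.map⁺ (All.map (λ { {_ , β} hβ → trans (degree-∙ α β) (trans (cong₂ _+_ hα hβ) (sym (fromℕ-+ l m))) }) hq))
  (homogeneous-*ᴾ l m hp hq)

homogeneous-𝓑 : ∀ n k → Homogeneous 1 (𝓑 n k)
homogeneous-𝓑 zero    k = []
homogeneous-𝓑 (suc n) k = degree-z n ∷ []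

homogeneous-𝓑^ : ∀ m n k → Homogeneous m ((𝓑 ^ˢ m) n k)
homogeneous-𝓑^ zero    zero    zero    = refl ∷ []
homogeneous-𝓑^ zero    zero    (suc k) = []
homogeneous-𝓑^ zero    (suc n) k       = []
homogeneous-𝓑^ (suc m) n       k       =
  homogeneous-∑ (suc m) n λ i → homogeneous-∑ (suc m) k λ j →
    homogeneous-*ᴾ 1 m (homogeneous-𝓑 i j) (homogeneous-𝓑^ m (n ∸ i) (k ∸ j))

coeffᴾ : ℚ → Poly → ℚ
coeffᴾ q p = coeff (map (map₂ degree) p) q

coeff-∷ : ∀ a r p q → coeff ((a , r) ∷ p) q ≡ 𝟙 (r ≟ℚ q) * a + coeff p q
coeff-∷ a r p q with r ≟ℚ q
... | yes _ = cong (_+ coeff p q) (sym (*-identityˡ a))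
... | no  _ = sym (trans (cong (_+ coeff p q) (*-zeroˡ a)) (+-identityˡ (coeff p q)))

coeffᴾ-++ : ∀ q p p′ → coeffᴾ q (p ++ p′) ≡ coeffᴾ q p + coeffᴾ q p′
coeffᴾ-++ q []            p′ = sym (+-identityˡ (coeffᴾ q p′))
coeffᴾ-++ q ((a , α) ∷ p) p′ = begin
  coeffᴾ q ((a , α) ∷ p ++ p′) ≡⟨ coeff-∷ a (degree α) _ q ⟩
  𝟙 (degree α ≟ℚ q) * a + coeffᴾ q (p ++ p′)
    ≡⟨ cong (𝟙 (degree α ≟ℚ q) * a +_) (coeffᴾ-++ q p p′) ⟩
  𝟙 (degree α ≟ℚ q) * a + (coeffᴾ q p + coeffᴾ q p′)
    ≡⟨ +-assoc (𝟙 (degree α ≟ℚ q) * a) (coeffᴾ q p) (coeffᴾ q p′) ⟨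
  𝟙 (degree α ≟ℚ q) * a + coeffᴾ q p + coeffᴾ q p′
    ≡⟨ cong (_+ coeffᴾ q p′) (coeff-∷ a (degree α) _ q) ⟨
  coeffᴾ q ((a , α) ∷ p) + coeffᴾ q p′ ∎

coeffᴾ-homogeneous : ∀ q m {p} → Homogeneous m p → coeffᴾ q p ≡ 𝟙 (fromℕ m ≟ℚ q) * total p
coeffᴾ-homogeneous q m                 []        = sym (*-zeroʳ (𝟙 (fromℕ m ≟ℚ q)))
coeffᴾ-homogeneous q m {(a , α) ∷ p} (hα ∷ hp) = begin
  coeffᴾ q ((a , α) ∷ p) ≡⟨ coeff-∷ a (degree α) _ q ⟩
  𝟙 (degree α ≟ℚ q) * a + coeffᴾ q p
    ≡⟨ cong₂ _+_ (cong (λ d → 𝟙 (d ≟ℚ q) * a) hα) (coeffᴾ-homogeneous q m hp) ⟩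
  𝟙 (fromℕ m ≟ℚ q) * a + 𝟙 (fromℕ m ≟ℚ q) * total p
    ≡⟨ *-distribˡ-+ (𝟙 (fromℕ m ≟ℚ q)) a (total p) ⟨
  𝟙 (fromℕ m ≟ℚ q) * total ((a , α) ∷ p) ∎

coeff-exp : ∀ n k q → coeff (τ (λ _ → 1ℚ) (exp 𝓑) n k) q ≡ ∑₊ n (λ m _ → 𝟙 (fromℕ m ≟ℚ q) * (b n k m * 1/ n !))
coeff-exp n k q = trans (∑-additive (coeffᴾ q) refl (coeffᴾ-++ q) n (λ m → 1/ m ! ·ᴾ (𝓑 ^ˢ m) n k))
  (∑₊-cong n λ m _ _ → begin
  coeffᴾ q (1/ m ! ·ᴾ (𝓑 ^ˢ m) n k)
    ≡⟨ coeffᴾ-homogeneous q m (All.map⁺ (homogeneous-𝓑^ m n k)) ⟩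
  𝟙 (fromℕ m ≟ℚ q) * total (1/ m ! ·ᴾ (𝓑 ^ˢ m) n k)
    ≡⟨ cong (𝟙 (fromℕ m ≟ℚ q) *_) (trans (Σ-map _ ((𝓑 ^ˢ m) n k) proj₁) (Σ-*ˡ ((𝓑 ^ˢ m) n k) (1/ m !) proj₁)) ⟩
  𝟙 (fromℕ m ≟ℚ q) * (1/ m ! * total ((𝓑 ^ˢ m) n k))
    ≡⟨ cong (𝟙 (fromℕ m ≟ℚ q) *_) (total-𝓑^ m n k) ⟩
  𝟙 (fromℕ m ≟ℚ q) * (b n k m * 1/ n !) ∎)

-- When n < ν the index ν is outside the range and the sum is 0; the hypothesis makes the right-hand
-- side agree in that case.
∑₊-select : ∀ n ν (a : ℕ → ℚ) → (n ℕ.< ν → a ν ≡ 0ℚ) → ∑₊ n (λ m _ → 𝟙 (m ≟ⁿ ν) * a m) ≡ a ν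
∑₊-select zero    zero    a a≡0 = *-identityˡ (a 0)
∑₊-select zero    (suc ν) a a≡0 = trans (*-zeroˡ (a 0)) (sym (a≡0 (s≤s z≤n)))
∑₊-select (suc n) zero    a a≡0 = begin
  1ℚ * a 0 + ∑₊ n (λ m _ → 0ℚ * a (suc m))
    ≡⟨ cong₂ _+_ (*-identityˡ (a 0)) (trans (∑₊-cong n (λ m _ _ → *-zeroˡ (a (suc m)))) (∑₊-zero n)) ⟩
  a 0 + 0ℚ ≡⟨ +-identityʳ (a 0) ⟩
  a 0 ∎
∑₊-select (suc n) (suc ν) a a≡0 = begin
  0ℚ * a 0 + ∑₊ n (λ m _ → 𝟙 (suc m ≟ⁿ suc ν) * a (suc m))
    ≡⟨ cong₂ _+_ (*-zeroˡ (a 0)) (∑₊-cong n (λ m _ _ →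
         cong (_* a (suc m)) (𝟙-⇔ (mk⇔ ℕ.suc-injective (cong suc)) (suc m ≟ⁿ suc ν) (m ≟ⁿ ν)))) ⟩
  0ℚ + ∑₊ n (λ m _ → 𝟙 (m ≟ⁿ ν) * a (suc m))
    ≡⟨ +-identityˡ _ ⟩
  ∑₊ n (λ m _ → 𝟙 (m ≟ⁿ ν) * a (suc m))
    ≡⟨ ∑₊-select n ν (a ∘ suc) (a≡0 ∘ s≤s) ⟩
  a (suc ν) ∎

expansion : τ (λ _ → 1ℚ) (exp 𝓑) HasExpansion b
expansion = record { natural = natural ; other = other }
  where
  natural : ∀ n k ν → coeff (τ (λ _ → 1ℚ) (exp 𝓑) n k) (fromℕ ν) ≡ b n k ν * 1/ n !
  natural n k ν = begin
    coeff (τ (λ _ → 1ℚ) (exp 𝓑) n k) (fromℕ ν) ≡⟨ coeff-exp n k (fromℕ ν) ⟩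
    ∑₊ n (λ m _ → 𝟙 (fromℕ m ≟ℚ fromℕ ν) * (b n k m * 1/ n !))
      ≡⟨ ∑₊-cong n (λ m _ _ → cong (_* (b n k m * 1/ n !))
           (𝟙-⇔ (mk⇔ fromℕ-injective (cong fromℕ)) (fromℕ m ≟ℚ fromℕ ν) (m ≟ⁿ ν))) ⟩
    ∑₊ n (λ m _ → 𝟙 (m ≟ⁿ ν) * (b n k m * 1/ n !))
      ≡⟨ ∑₊-select n ν (λ m → b n k m * 1/ n !) (λ n<ν →
           trans (cong (_* 1/ n !) (b-vanishes n k ν n<ν)) (*-zeroˡ (1/ n !))) ⟩
    b n k ν * 1/ n ! ∎

  other : ∀ n k q → (∀ ν → q ≢ fromℕ ν) → coeff (τ (λ _ → 1ℚ) (exp 𝓑) n k) q ≡ 0ℚ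
  other n k q q≢ = begin
    coeff (τ (λ _ → 1ℚ) (exp 𝓑) n k) q ≡⟨ coeff-exp n k q ⟩
    ∑₊ n (λ m _ → 𝟙 (fromℕ m ≟ℚ q) * (b n k m * 1/ n !))
      ≡⟨ ∑₊-cong n (λ m _ _ → trans (cong (_* (b n k m * 1/ n !)) (𝟙-no (fromℕ m ≟ℚ q) (q≢ m ∘ sym)))
                                    (*-zeroˡ (b n k m * 1/ n !))) ⟩
    ∑₊ n (λ _ _ → 0ℚ) ≡⟨ ∑₊-zero n ⟩
    0ℚ ∎

open _HasExpansion_

expansion-unique : ∀ {F c c′} → F HasExpansion c → F HasExpansion c′ → ∀ n k ν → c n k ν ≡ c′ n k ν
expansion-unique e e′ n k ν = *-cancelʳ-1/! n (trans (sym (natural e n k ν)) (natural e′ n k ν))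

corollary2 : (τ (λ _ → 1ℚ) (exp 𝓑) HasExpansion (λ n k ν → fromℕ (#bipartite n k ν)))
    × (∀ (b : ℕ → ℕ → ℕ → ℚ) → τ (λ _ → 1ℚ) (exp 𝓑) HasExpansion b →
    ∀ n k ν → b n k ν ≡ fromℕ (#bipartite n k ν))
corollary2 = expansion , λ b e → expansion-unique e expansion
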